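{- Let $t\ge2$, $N=t+2$, and let $\mathcal{T}_t$ be the set of partitions with at most $N$ parts of two-class profile. Let $(d_1,d_2,d_3)$ be an interval triple attained by some element of $\mathcal{T}_t$, and set $k_A=d_1/t-1$, $k_B=d_2/t-1$. The fibre $\{\lambda\in\mathcal{T}_t: (d_1(\lambda),d_2(\lambda),d_3(\lambda))=(d_1,d_2,d_3)\}$ is infinite. It is the disjoint union of branches indexed by the pairs $0\le r_A<r_B\le t-1$ and the signs $\eta=\pm1$ for which $$c:=\tfrac12\Bigl(\tfrac{\eta\,d_3-2(r_A-r_B)}{t}-k_A+k_B\Bigr)\in\mathbb{Z},$$ the two signs giving one and the same branch when $d_3=0$. The branch consists of the $\lambda\in\mathcal{T}_t$ with distinguished residues $r_A,r_B$ and $\lambda^{(r_A)}=(v+k_A,v)$, $\lambda^{(r_B)}=(v-c+k_B,v-c)$, $\lambda^{(i)}=(m_i)$ for $i\neq r_A,r_B$, the free parameters being an integer $v\ge\max(0,c)$ and $(m_i)\in\mathbb{Z}_{\ge0}^{t-2}$. Consequently $$\sum_{\lambda\text{ in the fibre}}q^{|\lambda|}=\frac{\sum_{\text{branches}}q^{\,e}}{(1-q^{4t})(1-q^t)^{t-2}},\qquad e=\kappa(r_A,r_B)+t(k_A+k_B-2c)+4t\max(0,c),$$ and the number of $\lambda$ in the fibre with $|\lambda|\le n$ is, for all sufficiently large $n$, a quasi-polynomial in $n$ of degree $t-1$.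
   Context: For $\lambda=(\lambda_1\ge\dots\ge\lambda_N\ge0)$ let $\beta_j=\lambda_j+N-j$ and $\beta(\lambda)=\{\beta_1>\dots>\beta_N\}$. $\lambda$ has two-class profile if exactly two residue classes modulo $t$, the distinguished residues $r_A<r_B$ in $\{0,\dots,t-1\}$, contain two elements of $\beta(\lambda)$, and every other class exactly one. If $\{a_1>a_2\}$, $\{b_1>b_2\}$ are the elements of $\beta(\lambda)$ in classes $r_A$, $r_B$, the interval triple of $\lambda$ is $d_1=a_1-a_2$, $d_2=b_1-b_2$, $d_3=|a_1+a_2-b_1-b_2|$. The $t$-quotient $(\lambda^{(0)},\dots,\lambda^{(t-1)})$ is computed from this $N$-element beta set: if the elements of $\beta(\lambda)$ congruent to $i$ are $t\tilde a_1+i>\dots>t\tilde a_{n}+i$, then $\lambda^{(i)}=(\tilde a_1-n+1,\dots,\tilde a_n)$. The $t$-core of $\lambda\in\mathcal{T}_t$ depends only on $(r_A,r_B)$ and $\kappa(r_A,r_B)$ denotes its size: it is the partition whose $N$-element beta set is $\{0,1,\dots,t-1\}\cup\{t+r_A,t+r_B\}$. -}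

module Defs where

open import Data.Nat as ℕ using (ℕ; suc; NonZero; _∸_; _≥_; ∣_-_∣)
import Data.Nat.Properties as ℕ
open import Data.Nat.ListAction using (sum)
open import Data.Nat.DivMod using (_%_) renaming (_/_ to _div_)
open import Data.Integer as ℤ using (ℤ; +_; _◃_; 0ℤ; 1ℤ; _⊔_)
open import Data.Rational as ℚ using (ℚ; 0ℚ; ½; ↥_; ↧ₙ_; _/_)
open import Data.Sign using (Sign)
open import Data.Fin as Fin using (Fin; toℕ; fromℕ)
import Data.Fin.Properties as Fin
open import Data.Vec using (Vec; toList)
open import Data.Vec.Relation.Unary.Linked using (Linked)
open import Data.List using (List; []; _∷_; length; map; filter; foldr;
  upTo; downFrom; allFin; cartesianProduct)
open import Data.List.Membership.Propositional using (_∈_)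
open import Data.List.Relation.Unary.Unique.Propositional using (Unique)
open import Data.Product using (Σ; ∃; ∃₂; _×_; _,_)
open import Data.Sum using (_⊎_)
open import Function.Bundles using (_⇔_)
open import Function.Definitions using (Injective)
open import Relation.Nullary.Decidable using (yes; no; _×-dec_)
open import Relation.Unary using (Pred; Decidable)
open import Relation.Binary.PropositionalEquality using (_≡_; _≢_)
open import Level using (0ℓ)

------------------------------------------------------------------------
-- Beta sets

-- A beta set is listed in decreasing order; the j-th of N entries of a
-- list (counting from 1) is followed by N - j others, so that the number
-- added or removed at each position is the length of the tail.

toBeta : List ℕ → List ℕ
toBeta []       = []
toBeta (x ∷ xs) = (x ℕ.+ length xs) ∷ toBeta xs

-- On a strictly decreasing list the subtraction is never truncated.

fromBeta : List ℕ → List ℕ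
fromBeta []       = []
fromBeta (b ∷ bs) = (b ∸ length bs) ∷ fromBeta bs

∣_∣ₚ : ∀ {N} → Vec ℕ N → ℕ
∣ ν ∣ₚ = sum (toList ν)

IsPartition : ∀ {N} → Pred (Vec ℕ N) 0ℓ
IsPartition = Linked _≥_

------------------------------------------------------------------------
-- Two-class profiles, interval triples, quotients

-- Candidate indices (r_A , r_B , η) of branches.

Label : ℕ → Set
Label t = Fin t × Fin t × Sign

-- For d₃ = 0 the two signs label the same branch, listed once.

signs : (d₃ : ℕ) → List Sign
signs 0       = Sign.+ ∷ []
signs (suc _) = Sign.+ ∷ Sign.- ∷ []

SameBranch : ∀ {t} → (d₃ : ℕ) → Label t → Label t → Set
SameBranch d₃ (rA , rB , η) (rA′ , rB′ , η′) =
  rA ≡ rA′ × rB ≡ rB′ × (η ≡ η′ ⊎ d₃ ≡ 0)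

module _ (t : ℕ) .{{_ : NonZero t}} where

  -- Elements of β(ν) congruent to i modulo t, in decreasing order.

  class : Vec ℕ (t ℕ.+ 2) → Fin t → List ℕ
  class ν i = filter (λ b → b % t ℕ.≟ toℕ i) (toBeta (toList ν))

  quotient : Vec ℕ (t ℕ.+ 2) → Fin t → List ℕ
  quotient ν i = fromBeta (map (_div t) (class ν i))

  record Distinguished (ν : Vec ℕ (t ℕ.+ 2)) (rA rB : Fin t) : Set where
    field
      rA<rB  : rA Fin.< rB
      two-A  : length (class ν rA) ≡ 2
      two-B  : length (class ν rB) ≡ 2
      others : ∀ i → i ≢ rA → i ≢ rB → length (class ν i) ≡ 1

  𝒯 : Pred (Vec ℕ (t ℕ.+ 2)) 0ℓ
  𝒯 ν = IsPartition ν × ∃₂ λ rA rB → Distinguished ν rA rB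

  record IntervalTriple (ν : Vec ℕ (t ℕ.+ 2)) (d₁ d₂ d₃ : ℕ) : Set where
    field
      {rA rB}       : Fin t
      distinguished : Distinguished ν rA rB
      {a₁ a₂ b₁ b₂} : ℕ
      class-A       : class ν rA ≡ a₁ ∷ a₂ ∷ []
      class-B       : class ν rB ≡ b₁ ∷ b₂ ∷ []
      d₁-def        : d₁ ≡ a₁ ∸ a₂
      d₂-def        : d₂ ≡ b₁ ∸ b₂
      d₃-def        : d₃ ≡ ∣ a₁ ℕ.+ a₂ - b₁ ℕ.+ b₂ ∣

  Fibre : (d₁ d₂ d₃ : ℕ) → Pred (Vec ℕ (t ℕ.+ 2)) 0ℓ
  Fibre d₁ d₂ d₃ ν = 𝒯 ν × IntervalTriple ν d₁ d₂ d₃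

  -- Since r_A < r_B < t, the elements of {0,…,t-1} ∪ {t+r_A, t+r_B} are
  -- listed here in decreasing order.

  core : (rA rB : Fin t) → List ℕ
  core rA rB = fromBeta ((t ℕ.+ toℕ rB) ∷ (t ℕ.+ toℕ rA) ∷ downFrom t)

  κ : (rA rB : Fin t) → ℕ
  κ rA rB = sum (core rA rB)

  ----------------------------------------------------------------------
  -- Branches

  module _ (d₃ kA kB : ℕ) where

    c-value : Label t → ℚ
    c-value (rA , rB , η) =
      ½ ℚ.* ((((η ◃ d₃) ℤ.- (+ 2) ℤ.* (+ toℕ rA ℤ.- + toℕ rB)) / t)
             ℚ.- (+ kA / 1) ℚ.+ (+ kB / 1))

    -- Rationals are kept in lowest terms: a rational is an integer exactly
    -- when its denominator is 1, and it then equals its numerator.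

    IsBranch : Pred (Label t) 0ℓ
    IsBranch ℓ@(rA , rB , _) = rA Fin.< rB × ↧ₙ (c-value ℓ) ≡ 1

    isBranch? : Decidable IsBranch
    isBranch? ℓ@(rA , rB , _) =
      (rA Fin.<? rB) ×-dec (↧ₙ (c-value ℓ) ℕ.≟ 1)

    -- Meaningful only for labels satisfying IsBranch.

    c : Label t → ℤ
    c ℓ = ↥ (c-value ℓ)

    record BranchPoint (ℓ : Label t) (v : ℤ)
        (m : let (rA , rB , _) = ℓ in (i : Fin t) → i ≢ rA → i ≢ rB → ℕ)
        (ν : Vec ℕ (t ℕ.+ 2)) : Set where
      private
        rA = let (r , _ , _) = ℓ in r
        rB = let (_ , r , _) = ℓ in r
      field
        partition     : IsPartition ν
        distinguished : Distinguished ν rA rB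
        quotient-A    : map +_ (quotient ν rA) ≡ (v ℤ.+ + kA) ∷ v ∷ []
        quotient-B    : map +_ (quotient ν rB)
                        ≡ (v ℤ.- c ℓ ℤ.+ + kB) ∷ (v ℤ.- c ℓ) ∷ []
        quotient-i    : ∀ i (i≢rA : i ≢ rA) (i≢rB : i ≢ rB) →
                        quotient ν i ≡ m i i≢rA i≢rB ∷ []

    Branch : Label t → Pred (Vec ℕ (t ℕ.+ 2)) 0ℓ
    Branch ℓ ν = ∃ λ v → 0ℤ ⊔ c ℓ ℤ.≤ v × ∃ λ m → BranchPoint ℓ v m ν

    branches : List (Label t)
    branches = filter isBranch?
      (cartesianProduct (allFin t) (cartesianProduct (allFin t) (signs d₃)))

    exponent : Label t → ℤ
    exponent ℓ@(rA , rB , _) =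
      + κ rA rB
      ℤ.+ + t ℤ.* (+ kA ℤ.+ + kB ℤ.- + 2 ℤ.* c ℓ)
      ℤ.+ + 4 ℤ.* + t ℤ.* (0ℤ ⊔ c ℓ)

------------------------------------------------------------------------
-- Infinite and finite sets

Infinite : {A : Set} → Pred A 0ℓ → Set
Infinite {A} P = Σ (ℕ → A) λ f → Injective _≡_ _≡_ f × (∀ n → P (f n))

HasCardinality : {A : Set} → Pred A 0ℓ → ℕ → Set
HasCardinality P k =
  ∃ λ xs → Unique xs × (∀ x → x ∈ xs ⇔ P x) × length xs ≡ k

------------------------------------------------------------------------
-- Formal power series in q over ℤ, as coefficient sequences

Series : Set
Series = ℕ → ℤ

sumℤ : List ℤ → ℤ
sumℤ = foldr ℤ._+_ 0ℤ

infixl 7 _⊛_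
infixl 6 _⊖_
infixr 8 _^ˢ_

_⊖_ : Series → Series → Series
(f ⊖ g) n = f n ℤ.- g n

_⊛_ : Series → Series → Series
(f ⊛ g) n = sumℤ (map (λ k → f k ℤ.* g (n ∸ k)) (upTo (suc n)))

-- The exponents of the monomials used are nonnegative.

q^_ : ℤ → Series
(q^ e) n with + n ℤ.≟ e
... | yes _ = 1ℤ
... | no  _ = 0ℤ

1ˢ : Series
1ˢ = q^ 0ℤ

_^ˢ_ : Series → ℕ → Series
f ^ˢ ℕ.zero = 1ˢ
f ^ˢ suc n  = f ⊛ f ^ˢ n

Σˢ : {A : Set} → List A → (A → Series) → Series
Σˢ xs f n = sumℤ (map (λ x → f x n) xs)

-- F is the quotient of num by den; multiplication by den is cancellable
-- when den has constant coefficient 1.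

_≗_÷_ : (F num den : Series) → Set
F ≗ num ÷ den = ∀ n → (F ⊛ den) n ≡ num n

------------------------------------------------------------------------
-- Quasi-polynomials

sumℚ : List ℚ → ℚ
sumℚ = foldr ℚ._+_ 0ℚ

Periodic : (ℕ → ℚ) → Set
Periodic f = ∃ λ p → 0 ℕ.< p × (∀ n → f (n ℕ.+ p) ≡ f n)

record IsQuasiPolynomial (deg : ℕ) (f : ℕ → ℚ) : Set where
  field
    coeff    : Fin (suc deg) → ℕ → ℚ
    periodic : ∀ i → Periodic (coeff i)
    leading  : ∃ λ n → coeff (fromℕ deg) n ≢ 0ℚ
    formula  : ∀ n → f n ≡
      sumℚ (map (λ i → coeff i n ℚ.* (+ (n ℕ.^ toℕ i) / 1)) (allFin (suc deg)))

{-# OPTIONS --safe #-}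

-- A partition of two-class profile amounts to its distinguished residues
-- rA < rB, the least element of every residue class of its beta set, and the
-- two differences kA, kB inside the distinguished classes; any such data
-- occurs. If t v + rA and t w + rB are the least elements of the two
-- distinguished classes, then
--   a₁ + a₂ - b₁ - b₂ = 2t (v - w) + 2 (rA - rB) + t (kA - kB),
-- so prescribing d₃ up to the sign η prescribes v - w = c, which is the
-- integrality condition on branches. The size is affine in the remaining
-- parameters: with u = v - max(0,c) it is e + t (4u + Σ mᵢ), whence the
-- generating function. Counting solutions of 4u + Σ mᵢ ≤ M one variable at a
-- time, each count has the previous one as a difference, so that summation
-- raises the degree of the quasi-polynomial by one and keeps its leading
-- coefficient a positive constant.

module Submission where

open import Defs
open import Data.Nat as ℕ using (ℕ; zero; suc; NonZero; _≤_; _≥_; _<_; _>_; _+_; _*_; _∸_; _^_; ∣_-_∣; z≤n; s≤s)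
import Data.Nat.Properties as ℕ
open import Data.Nat.DivMod using (_%_) renaming (_/_ to _div_)
import Data.Nat.DivMod as DM
open import Data.Nat.Divisibility using (divides)
import Data.Nat.Coprimality as C
open import Data.Nat.ListAction using (sum)
open import Data.Nat.ListAction.Properties using (sum-↭)
import Data.Nat.Tactic.RingSolver as ℕ-Ring
open import Data.Integer as ℤ using (ℤ; +_; 0ℤ; 1ℤ; _◃_)
open import Data.Integer using () renaming (+_ to pos)
import Data.Integer.Properties as ℤ
import Data.Integer.Tactic.RingSolver as ℤ-Ring
open import Data.Rational as ℚ using (ℚ; _/_; 0ℚ; 1ℚ; ½; ↥_; ↧ₙ_)
import Data.Rational.Properties as ℚ
import Data.Rational.Unnormalised as ℚᵘ
import Data.Rational.Unnormalised.Properties as ℚᵘ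
import Data.Rational.Solver as ℚ-Solver
open import Data.Sign using (Sign)
open import Data.Fin as Fin using (Fin; toℕ; punchOut)
import Data.Fin.Properties as Fin
open import Data.Vec as Vec using (Vec; []; _∷_; toList; lookup; insertAt; removeAt)
import Data.Vec.Properties as Vec
open import Data.Vec.Relation.Unary.Linked using ([]; [-]; _∷_)
open import Data.List as List using (List; []; _∷_; _++_; length; map; downFrom; allFin; tabulate; cartesianProduct; applyUpTo)
import Data.List.Properties as List
open import Data.List.Membership.Propositional using (_∈_)
import Data.List.Membership.Propositional.Properties as ∈
open import Data.List.Relation.Unary.Any using (here; there)
open import Data.List.Relation.Unary.All as All using (All; []; _∷_)
import Data.List.Relation.Unary.All.Properties as All
open import Data.List.Relation.Unary.AllPairs as AllPairs using (AllPairs; []; _∷_)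
import Data.List.Relation.Unary.AllPairs.Properties as AllPairs
open import Data.List.Relation.Unary.Linked as Linked using (Linked; []; [-]; _∷_)
import Data.List.Relation.Unary.Linked.Properties as Linked
open import Data.List.Relation.Unary.Unique.Propositional using (Unique)
import Data.List.Relation.Unary.Unique.Propositional.Properties as Unique
open import Data.List.Relation.Binary.Permutation.Propositional using (_↭_; ↭-sym; ↭⇒↭ₛ)
import Data.List.Relation.Binary.Permutation.Propositional.Properties as ↭
import Data.List.Relation.Binary.Permutation.Setoid.Properties as ↭ₛ
import Data.List.Sort as Sort
import Relation.Binary.Construct.Flip.EqAndOrd as Flip
open import Data.Product using (∃; ∃₂; ∃!; _×_; _,_; proj₁; proj₂)
open import Data.Sum as Sum using (_⊎_; inj₁; inj₂)
open import Data.Empty using (⊥-elim)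
open import Function using (_∘_; id; case_of_)
open import Function.Bundles using (_⇔_; mk⇔; module Equivalence)
open import Relation.Nullary using (¬_; yes; no; contradiction)
open import Relation.Unary using (Pred)
open import Relation.Binary.PropositionalEquality using (_≡_; _≢_; refl; sym; trans; cong; cong₂; subst; subst₂; setoid; module ≡-Reasoning)
open import Level using (0ℓ)

-- The obstacle is the leading coefficient: a sum of quasi-polynomials loses degree when periodic
-- leading coefficients cancel. The count in u alone is the indicator of 4 | M, which is not
-- constant, so increments are taken over blocks of four consecutive M, that is, over the period 4t
-- in n; each block contains exactly one multiple of 4. From the next variable on the leading
-- coefficient is constant, and neither translation by e nor summation over the branches can destroy
-- it. The bound |λ| ≤ n contributes a slack variable to the t - 2 variables mᵢ, whence the degree t
-- - 1.
--
-- No power series is inverted: a factor 1 - q^k of the denominator acts as a difference operator,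
-- and each such operator undoes one step of the recursion that defines the count.
--
-- Since c is given as a rational number, its integrality is traded for an integer equation with the
-- denominators 2 and t cleared, solved by z = v - w.

⇔-to : ∀ {A B : Set} → A ⇔ B → A → B
⇔-to = Equivalence.to

⇔-from : ∀ {A B : Set} → A ⇔ B → B → A
⇔-from = Equivalence.from

-- Strictly decreasing lists and beta sets

Descending : List ℕ → Set
Descending = AllPairs _>_

linked⇒descending : ∀ {xs} → Linked _>_ xs → Descending xs
linked⇒descending = Linked.Linked⇒AllPairs (λ p q → ℕ.<-trans q p)

-- Each head is the maximum of the common set, so the heads agree; strictness keeps the head out of
-- the tail, so the tails again have the same elements. This reduces every equality of classes or
-- beta sets to membership.
descending-unique : ∀ {xs ys} → Descending xs → Descending ys →
                    (∀ z → z ∈ xs ⇔ z ∈ ys) → xs ≡ ys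
descending-unique {[]}     {[]}     _ _ _ = refl
descending-unique {[]}     {y ∷ ys} _ _ same with () ← ⇔-from (same y) (here refl)
descending-unique {x ∷ xs} {[]}     _ _ same with () ← ⇔-to (same x) (here refl)
descending-unique {x ∷ xs} {y ∷ ys} (x> ∷ xs>) (y> ∷ ys>) same =
  cong₂ _∷_ x≡y (descending-unique xs> ys> λ z → mk⇔
    (λ z∈ → drop-head (⇔-to (same z) (there z∈))
      λ z≡y → ℕ.<⇒≢ (All.lookup x> z∈) (trans z≡y (sym x≡y)))
    (λ z∈ → drop-head (⇔-from (same z) (there z∈))
      λ z≡x → ℕ.<⇒≢ (All.lookup y> z∈) (trans z≡x x≡y)))
  where
  drop-head : ∀ {z w ws} → z ∈ w ∷ ws → z ≢ w → z ∈ ws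
  drop-head (here z≡w)  z≢w = contradiction z≡w z≢w
  drop-head (there z∈)  _   = z∈

  ≤-head : ∀ {z w ws} → All (w >_) ws → z ∈ w ∷ ws → z ≤ w
  ≤-head _  (here refl) = ℕ.≤-refl
  ≤-head w> (there z∈)  = ℕ.<⇒≤ (All.lookup w> z∈)

  x≡y : x ≡ y
  x≡y = ℕ.≤-antisym (≤-head y> (⇔-to (same x) (here refl)))
                    (≤-head x> (⇔-from (same y) (here refl)))

length-toBeta : ∀ xs → length (toBeta xs) ≡ length xs
length-toBeta []       = refl
length-toBeta (x ∷ xs) = cong suc (length-toBeta xs)

toBeta-injective : ∀ {n} (ν ν′ : Vec ℕ n) →
                   toBeta (toList ν) ≡ toBeta (toList ν′) → ν ≡ ν′
toBeta-injective []      []        _  = refl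
toBeta-injective (x ∷ ν) (x′ ∷ ν′) eq
  with refl ← toBeta-injective ν ν′ (List.∷-injectiveʳ eq)
  = cong (_∷ ν) (ℕ.+-cancelʳ-≡ (length (toList ν)) x x′ (List.∷-injectiveˡ eq))

toBeta-linked : ∀ {n} {ν : Vec ℕ n} → IsPartition ν → Linked _>_ (toBeta (toList ν))
toBeta-linked []            = []
toBeta-linked [-]           = [-]
toBeta-linked {ν = x ∷ y ∷ ν} (x≥y ∷ p) =
  ℕ.≤-trans (ℕ.≤-reflexive (sym (ℕ.+-suc y _))) (ℕ.+-monoˡ-≤ _ x≥y) ∷ toBeta-linked p

toBeta-descending : ∀ {n} {ν : Vec ℕ n} → IsPartition ν → Descending (toBeta (toList ν))
toBeta-descending = linked⇒descending ∘ toBeta-linked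

fromBeta-toBeta : ∀ xs → fromBeta (toBeta xs) ≡ xs
fromBeta-toBeta []       = refl
fromBeta-toBeta (x ∷ xs) = cong₂ _∷_
  (trans (cong ((x + length xs) ∸_) (length-toBeta xs)) (ℕ.m+n∸n≡m x (length xs)))
  (fromBeta-toBeta xs)

-- A strict descent from `b` to the next entry `y + length ν′` means `y + l ≤ b` with `l` one larger
-- than that length. This makes the subtraction `b ∸ l` exact and its result at least `y`.
toBeta-surjective : ∀ n L → length L ≡ n → Linked _>_ L →
                    ∃ λ (ν : Vec ℕ n) → IsPartition ν × toBeta (toList ν) ≡ L
toBeta-surjective zero    []      refl _ = [] , [] , refl
toBeta-surjective (suc n) (b ∷ L) len  b∷L
  with toBeta-surjective n L (ℕ.suc-injective len) (Linked.tail b∷L)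
... | [] , _ , refl = (b ∷ []) , [-] , cong (_∷ []) (ℕ.+-identityʳ b)
... | ν@(y ∷ ν′) , p , refl with b>y+l ∷ _ ← b∷L =
  ((b ∸ l) ∷ ν) , (y≤b∸l ∷ p) , cong (_∷ _) (ℕ.m∸n+n≡m l≤b)
  where
  l = suc (length (toList ν′))

  y+l≤b : y + l ≤ b
  y+l≤b = ℕ.≤-trans (ℕ.≤-reflexive (ℕ.+-suc y _)) b>y+l

  l≤b : l ≤ b
  l≤b = ℕ.≤-trans (ℕ.m≤n+m l y) y+l≤b

  y≤b∸l : y ≤ b ∸ l
  y≤b∸l = ℕ.m+n≤o⇒m≤o∸n y y+l≤b

-- The staircase N - 1, ..., 0 added to the parts depends only on N, so it cancels when the size of
-- a partition is compared with that of its core.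
sum-toBeta : ∀ xs → sum (toBeta xs) ≡ sum xs + sum (downFrom (length xs))
sum-toBeta []       = refl
sum-toBeta (x ∷ xs) = trans (cong (λ s → x + length xs + s) (sum-toBeta xs))
  (interchange x (length xs) (sum xs) (sum (downFrom (length xs))))
  where
  interchange : ∀ a b c d → a + b + (c + d) ≡ a + c + (b + d)
  interchange = ℕ-Ring.solve-∀

size-beta : ∀ {n} (ν : Vec ℕ n) → sum (toBeta (toList ν)) ≡ ∣ ν ∣ₚ + sum (downFrom n)
size-beta ν = trans (sum-toBeta (toList ν))
  (cong (λ n → ∣ ν ∣ₚ + sum (downFrom n)) (Vec.length-toList ν))

sum-fromBeta : ∀ {n L} → length L ≡ n → Linked _>_ L →
               sum L ≡ sum (fromBeta L) + sum (downFrom n)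
sum-fromBeta {n} {L} len L> with ν , _ , refl ← toBeta-surjective n L len L> =
  trans (size-beta ν)
    (cong (λ xs → sum xs + sum (downFrom n)) (sym (fromBeta-toBeta (toList ν))))

-- ≥ replaces ≤ because beta sets are listed in decreasing order.
module ≥-Sort = Sort (Flip.decTotalOrder ℕ.≤-decTotalOrder)

sort-descending : ∀ {L} → Unique L → Linked _>_ (≥-Sort.sort L)
sort-descending {L} unique = strict (≥-Sort.sort-↗ L)
  (↭ₛ.Unique-resp-↭ (setoid ℕ) (↭⇒↭ₛ (↭-sym (≥-Sort.sort-↭ L))) unique)
  where
  strict : ∀ {xs} → Linked _≥_ xs → Unique xs → Linked _>_ xs
  strict []        _                  = []
  strict [-]       _                  = [-]
  strict (x≥y ∷ l) ((x≢y ∷ _) ∷ u) = ℕ.≤∧≢⇒< x≥y (x≢y ∘ sym) ∷ strict l u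

-- Partitions encoded by their residue classes

sum-tabulate-affine : ∀ n (f g : Fin n → ℕ) a →
  sum (tabulate (λ i → f i + g i * a)) ≡ sum (tabulate f) + sum (tabulate g) * a
sum-tabulate-affine zero    f g a = refl
sum-tabulate-affine (suc n) f g a =
  trans (cong (λ s → f Fin.zero + g Fin.zero * a + s)
           (sum-tabulate-affine n (f ∘ Fin.suc) (g ∘ Fin.suc) a))
    (regroup (f Fin.zero) (g Fin.zero) a (sum (tabulate (f ∘ Fin.suc)))
      (sum (tabulate (g ∘ Fin.suc))))
  where
  regroup : ∀ p q a r s → p + q * a + (r + s * a) ≡ p + r + (q + s) * a
  regroup = ℕ-Ring.solve-∀

sum-tabulate-suc : ∀ n (f : Fin n → ℕ) →
  sum (tabulate (suc ∘ f)) ≡ n + sum (tabulate f)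
sum-tabulate-suc zero    f = refl
sum-tabulate-suc (suc n) f = cong suc
  (trans (cong (λ s → f Fin.zero + s) (sum-tabulate-suc n (f ∘ Fin.suc)))
    (swap (f Fin.zero) n (sum (tabulate (f ∘ Fin.suc)))))
  where
  swap : ∀ a b c → a + (b + c) ≡ b + (a + c)
  swap = ℕ-Ring.solve-∀

sum-toℕ : ∀ n → sum (tabulate {n = n} toℕ) ≡ sum (downFrom n)
sum-toℕ zero    = refl
sum-toℕ (suc n) = trans (sum-tabulate-suc n toℕ) (cong (λ s → n + s) (sum-toℕ n))

downFrom-linked : ∀ {m} n → n ≤ m → Linked _>_ (m ∷ downFrom n)
downFrom-linked zero    _   = [-]
downFrom-linked (suc n) n<m = n<m ∷ downFrom-linked n ℕ.≤-refl

-- In a decreasing list the last entry is the least. The value at `[]` is a placeholder: in a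
-- two-class profile no class is empty.
lowest : List ℕ → ℕ
lowest []           = 0
lowest (x ∷ [])     = x
lowest (_ ∷ y ∷ xs) = lowest (y ∷ xs)

module _ (t : ℕ) .{{_ : NonZero t}} where

  -- Abstract so that unification does not unfold it.

  abstract
    bead : Fin t → ℕ → ℕ
    bead i q = toℕ i + q * t

    bead-def : ∀ i q → bead i q ≡ toℕ i + q * t
    bead-def i q = refl

    bead-% : ∀ i q → bead i q % t ≡ toℕ i
    bead-% i q = trans (DM.[m+kn]%n≡m%n (toℕ i) q t) (DM.m<n⇒m%n≡m (Fin.toℕ<n i))

    bead-div : ∀ i q → bead i q div t ≡ q
    bead-div i q = begin
      (toℕ i + q * t) div t      ≡⟨ DM.+-distrib-/-∣ʳ (toℕ i) (divides q refl) ⟩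
      toℕ i div t + q * t div t  ≡⟨ cong₂ _+_ (DM.m<n⇒m/n≡0 (Fin.toℕ<n i)) (DM.m*n/n≡m q t) ⟩
      q                          ∎
      where open ≡-Reasoning

    residue⇒bead : ∀ {z i} → z % t ≡ toℕ i → z ≡ bead i (z div t)
    residue⇒bead {z} eq = trans (DM.m≡m%n+[m/n]*n z t) (cong (λ r → r + z div t * t) eq)

    bead-mono : ∀ {p q} i → p < q → bead i p < bead i q
    bead-mono i p<q = ℕ.+-monoʳ-< (toℕ i) (ℕ.*-monoˡ-< t p<q)

    bead-mono⁻¹ : ∀ {p q} i → bead i p < bead i q → p < q
    bead-mono⁻¹ {p} {q} i lt = ℕ.*-cancelʳ-< t p q (ℕ.+-cancelˡ-< (toℕ i) (p * t) (q * t) lt)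

  bead-injectiveˡ : ∀ {i j p q} → bead i p ≡ bead j q → i ≡ j
  bead-injectiveˡ {i} {j} {p} {q} eq = Fin.toℕ-injective
    (trans (sym (bead-% i p)) (trans (cong (_% t) eq) (bead-% j q)))

  bead-injectiveʳ : ∀ {i j p q} → bead i p ≡ bead j q → p ≡ q
  bead-injectiveʳ {i} {j} {p} {q} eq =
    trans (sym (bead-div i p)) (trans (cong (_div t) eq) (bead-div j q))

  class-∈⁺ : ∀ (ν : Vec ℕ (t + 2)) {i z} → z ∈ toBeta (toList ν) → z % t ≡ toℕ i → z ∈ class t ν i
  class-∈⁺ ν {i} = ∈.∈-filter⁺ (λ b → b % t ℕ.≟ toℕ i)

  class-∈⁻ : ∀ (ν : Vec ℕ (t + 2)) i {z} → z ∈ class t ν i → z ∈ toBeta (toList ν) × z % t ≡ toℕ i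
  class-∈⁻ ν i = ∈.∈-filter⁻ (λ b → b % t ℕ.≟ toℕ i)

  class-descending : ∀ {ν} i → IsPartition ν → Descending (class t ν i)
  class-descending i p = AllPairs.filter⁺ (λ b → b % t ℕ.≟ toℕ i) (toBeta-descending p)

  class-unique : ∀ {ν i ys} → IsPartition ν → Descending ys →
    (∀ {z} → z ∈ toBeta (toList ν) → z % t ≡ toℕ i → z ∈ ys) →
    (∀ {z} → z ∈ ys → z ∈ toBeta (toList ν) × z % t ≡ toℕ i) →
    class t ν i ≡ ys
  class-unique {ν} {i} p ys> to from = descending-unique (class-descending i p) ys> λ z → mk⇔
    (λ z∈ → case class-∈⁻ ν i z∈ of λ (z∈ν , z≡i) → to z∈ν z≡i)
    (λ z∈ → case from z∈ of λ (z∈ν , z≡i) → class-∈⁺ ν z∈ν z≡i)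

  -- The classes exhaust the beta set, since every element lies in the class of its own remainder
  -- modulo t.
  classes-determine : ∀ {ν ν′} → IsPartition ν → IsPartition ν′ →
                      (∀ i → class t ν i ≡ class t ν′ i) → ν ≡ ν′
  classes-determine {ν} {ν′} p p′ same = toBeta-injective ν ν′
    (descending-unique (toBeta-descending p) (toBeta-descending p′) λ z →
      mk⇔ (transfer ν ν′ same) (transfer ν′ ν (sym ∘ same)))
    where
    transfer : ∀ (μ μ′ : Vec ℕ (t + 2)) → (∀ i → class t μ i ≡ class t μ′ i) →
               ∀ {z} → z ∈ toBeta (toList μ) → z ∈ toBeta (toList μ′)
    transfer μ μ′ same {z} z∈ = proj₁ (class-∈⁻ μ′ i
      (subst (z ∈_) (same i) (class-∈⁺ μ z∈ (sym (Fin.toℕ-fromℕ< (DM.m%n<n z t))))))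
      where i = Fin.fromℕ< (DM.m%n<n z t)

  -- A class with two elements must be one of the two distinguished ones, as every other class has
  -- one; the order of the residues excludes a swap or a repetition.
  distinguished-unique : ∀ {ν rA rB rA′ rB′} →
    Distinguished t ν rA rB → Distinguished t ν rA′ rB′ → rA ≡ rA′ × rB ≡ rB′
  distinguished-unique {ν} {rA} {rB} {rA′} {rB′} d d′
    with one-of rA′ (two-A d′) | one-of rB′ (two-B d′)
    where
    open Distinguished
    one-of : ∀ i → length (class t ν i) ≡ 2 → i ≡ rA ⊎ i ≡ rB
    one-of i two with i Fin.≟ rA | i Fin.≟ rB
    ... | yes i≡ | _      = inj₁ i≡
    ... | no  _  | yes i≡ = inj₂ i≡
    ... | no  i≢ | no i≢′ with () ← trans (sym two) (others d i i≢ i≢′)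
  ... | inj₁ refl | inj₁ refl = contradiction (Distinguished.rA<rB d′) (ℕ.<-irrefl refl)
  ... | inj₁ refl | inj₂ refl = refl , refl
  ... | inj₂ refl | inj₁ refl =
    contradiction (Distinguished.rA<rB d′) (ℕ.<-asym (Distinguished.rA<rB d))
  ... | inj₂ refl | inj₂ refl = contradiction (Distinguished.rA<rB d′) (ℕ.<-irrefl refl)

  -- x i is the quotient by t of the least element of class i; in the two
  -- distinguished classes the larger element lies kA + 1, respectively
  -- kB + 1, multiples of t higher.

  record Coded (rA rB : Fin t) (kA kB : ℕ) (x : Fin t → ℕ) (ν : Vec ℕ (t + 2)) : Set where
    field
      partition : IsPartition ν
      rA<rB     : rA Fin.< rB
      class-A   : class t ν rA ≡ bead rA (suc (x rA + kA)) ∷ bead rA (x rA) ∷ []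
      class-B   : class t ν rB ≡ bead rB (suc (x rB + kB)) ∷ bead rB (x rB) ∷ []
      class-i   : ∀ i → i ≢ rA → i ≢ rB → class t ν i ≡ bead i (x i) ∷ []

  open Coded

  coded⇒distinguished : ∀ {rA rB kA kB x ν} → Coded rA rB kA kB x ν → Distinguished t ν rA rB
  coded⇒distinguished C = record
    { rA<rB  = rA<rB C
    ; two-A  = cong length (class-A C)
    ; two-B  = cong length (class-B C)
    ; others = λ i i≢ i≢′ → cong length (class-i C i i≢ i≢′)
    }

  pair-quotient : ∀ i p q → map (_div t) (bead i p ∷ bead i q ∷ []) ≡ p ∷ q ∷ []
  pair-quotient i p q = cong₂ (λ a b → a ∷ b ∷ []) (bead-div i p) (bead-div i q)

  coded-quotient-A : ∀ {rA rB kA kB x ν} → Coded rA rB kA kB x ν →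
                     quotient t ν rA ≡ (x rA + kA) ∷ x rA ∷ []
  coded-quotient-A {rA} C = cong fromBeta
    (trans (cong (map (_div t)) (class-A C)) (pair-quotient rA _ _))

  coded-quotient-B : ∀ {rA rB kA kB x ν} → Coded rA rB kA kB x ν →
                     quotient t ν rB ≡ (x rB + kB) ∷ x rB ∷ []
  coded-quotient-B {rB = rB} C = cong fromBeta
    (trans (cong (map (_div t)) (class-B C)) (pair-quotient rB _ _))

  coded-quotient-i : ∀ {rA rB kA kB x ν} → Coded rA rB kA kB x ν →
                     ∀ i → i ≢ rA → i ≢ rB → quotient t ν i ≡ x i ∷ []
  coded-quotient-i {x = x} C i i≢ i≢′ = cong fromBeta
    (trans (cong (map (_div t)) (class-i C i i≢ i≢′)) (cong (_∷ []) (bead-div i (x i))))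

  coded-cong : ∀ {rA rB kA kB x y ν} → (∀ i → x i ≡ y i) →
               Coded rA rB kA kB x ν → Coded rA rB kA kB y ν
  coded-cong {rA} {rB} {kA} {kB} x≗y C = record
    { partition = partition C
    ; rA<rB     = rA<rB C
    ; class-A   = trans (class-A C)
        (cong (λ z → bead rA (suc (z + kA)) ∷ bead rA z ∷ []) (x≗y rA))
    ; class-B   = trans (class-B C)
        (cong (λ z → bead rB (suc (z + kB)) ∷ bead rB z ∷ []) (x≗y rB))
    ; class-i   = λ i i≢ i≢′ → trans (class-i C i i≢ i≢′) (cong (λ z → bead i z ∷ []) (x≗y i))
    }

  coded-unique : ∀ {rA rB kA kB x ν ν′} → Coded rA rB kA kB x ν → Coded rA rB kA kB x ν′ → ν ≡ ν′
  coded-unique {rA} {rB} {ν = ν} {ν′} C C′ = classes-determine (partition C) (partition C′) same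
    where
    same : ∀ i → class t ν i ≡ class t ν′ i
    same i with i Fin.≟ rA | i Fin.≟ rB
    ... | yes refl | _        = trans (class-A C) (sym (class-A C′))
    ... | no  _    | yes refl = trans (class-B C) (sym (class-B C′))
    ... | no  i≢   | no i≢′   = trans (class-i C i i≢ i≢′) (sym (class-i C′ i i≢ i≢′))

  -- The quotients depend on `ν` alone, and the last entry of the i-th one is the level of class i.
  coded-x-unique : ∀ {rA rB kA kB kA′ kB′ x y ν} →
    Coded rA rB kA kB x ν → Coded rA rB kA′ kB′ y ν → ∀ i → x i ≡ y i
  coded-x-unique {rA} {rB} C C′ i with i Fin.≟ rA | i Fin.≟ rB
  ... | yes refl | _        = List.∷-injectiveˡ (List.∷-injectiveʳ
    (trans (sym (coded-quotient-A C)) (coded-quotient-A C′)))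
  ... | no  _    | yes refl = List.∷-injectiveˡ (List.∷-injectiveʳ
    (trans (sym (coded-quotient-B C)) (coded-quotient-B C′)))
  ... | no  i≢   | no i≢′   = List.∷-injectiveˡ
    (trans (sym (coded-quotient-i C i i≢ i≢′)) (coded-quotient-i C′ i i≢ i≢′))

  pair-beads : ∀ {xs} i → Descending xs → (∀ {z} → z ∈ xs → z % t ≡ toℕ i) → length xs ≡ 2 →
    let y = lowest xs div t in ∃ λ k → xs ≡ bead i (suc (y + k)) ∷ bead i y ∷ []
  pair-beads {a₁ ∷ a₂ ∷ []} i ((a₁>a₂ ∷ []) ∷ _) res _ =
    -- Both elements have the same residue, so their order is that of their quotients: `q < p`, and
    -- the subtraction is exact.
    p ∸ suc q , cong₂ (λ a b → a ∷ b ∷ [])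
      (trans a₁≡ (cong (bead i) (sym (ℕ.m+[n∸m]≡n q<p)))) a₂≡
    where
    p = a₁ div t
    q = a₂ div t
    a₁≡ = residue⇒bead {a₁} {i} (res (here refl))
    a₂≡ = residue⇒bead {a₂} {i} (res (there (here refl)))
    q<p = bead-mono⁻¹ i (subst₂ _<_ a₂≡ a₁≡ a₁>a₂)

  single-bead : ∀ {xs} i → (∀ {z} → z ∈ xs → z % t ≡ toℕ i) → length xs ≡ 1 →
                xs ≡ bead i (lowest xs div t) ∷ []
  single-bead {a ∷ []} i res _ = cong (_∷ []) (residue⇒bead {a} {i} (res (here refl)))

  decode : ∀ {ν rA rB} → IsPartition ν → Distinguished t ν rA rB →
           ∃ λ kA → ∃ λ kB → ∃ λ x → Coded rA rB kA kB x ν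
  decode {ν} {rA} {rB} p d =
    let kA , class-A = pair-beads rA (class-descending rA p) (residue rA) two-A
        kB , class-B = pair-beads rB (class-descending rB p) (residue rB) two-B
    in kA , kB , (λ i → lowest (class t ν i) div t) , record
      { partition = p
      ; rA<rB     = rA<rB′
      ; class-A   = class-A
      ; class-B   = class-B
      ; class-i   = λ i i≢ i≢′ → single-bead i (residue i) (others i i≢ i≢′)
      }
    where
    open Distinguished d using (two-A; two-B; others) renaming (rA<rB to rA<rB′)
    residue : ∀ i {z} → z ∈ class t ν i → z % t ≡ toℕ i
    residue i = proj₂ ∘ class-∈⁻ ν i

  -- Existence of a partition with prescribed residues, levels and differences

  module _ {rA rB : Fin t} (A<B : rA Fin.< rB) (kA kB : ℕ) (x : Fin t → ℕ) where

    -- The tabulated part supplies the least element of every class, the two entries in front the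
    -- larger elements of the distinguished ones. The order is repaired by sorting, which affects
    -- neither membership nor the sum.
    beads : List ℕ
    beads = bead rA (suc (x rA + kA)) ∷ bead rB (suc (x rB + kB)) ∷ tabulate (λ i → bead i (x i))

    private
      rA≢rB : rA ≢ rB
      rA≢rB refl = ℕ.<-irrefl refl A<B

      ∉-lower : ∀ i {p} → x i < p → All (bead i p ≢_) (tabulate (λ i → bead i (x i)))
      ∉-lower i x<p = All.tabulate⁺ λ j eq → case bead-injectiveˡ {i} {j} eq of λ where
        refl → ℕ.<⇒≢ x<p (sym (bead-injectiveʳ {i} {i} eq))

      beads-unique : Unique beads
      beads-unique =
        ((λ eq → rA≢rB (bead-injectiveˡ {rA} {rB} eq)) ∷ ∉-lower rA (s≤s (ℕ.m≤m+n _ _))) ∷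
        ∉-lower rB (s≤s (ℕ.m≤m+n _ _)) ∷
        Unique.tabulate⁺ bead-injectiveˡ

      module _ {ν : Vec ℕ (t + 2)} (p : IsPartition ν) (ν≡ : toBeta (toList ν) ≡ ≥-Sort.sort beads) where

        ∈⁻ : ∀ {z} → z ∈ toBeta (toList ν) → z ∈ beads
        ∈⁻ {z} z∈ = ↭.∈-resp-↭ (≥-Sort.sort-↭ beads) (subst (z ∈_) ν≡ z∈)

        ∈⁺ : ∀ {z} → z ∈ beads → z ∈ toBeta (toList ν)
        ∈⁺ {z} z∈ = subst (z ∈_) (sym ν≡) (↭.∈-resp-↭ (↭-sym (≥-Sort.sort-↭ beads)) z∈)

        lower∈ : ∀ i → bead i (x i) ∈ beads
        lower∈ i = there (there (∈.∈-tabulate⁺ i))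

        has-residue : ∀ {i z} q → z ≡ bead i q → z % t ≡ toℕ i
        has-residue {i} q eq = trans (cong (_% t) eq) (bead-% i q)

        sort-coded : Coded rA rB kA kB x ν
        sort-coded .partition = p
        sort-coded .rA<rB     = A<B
        sort-coded .class-A   = class-unique {i = rA} p
          ((bead-mono rA (s≤s (ℕ.m≤m+n _ _)) ∷ []) ∷ [] ∷ [])
          (λ z∈ res → case ∈⁻ z∈ of λ where
            (here eq)         → here eq
            (there (here eq)) → contradiction
              (Fin.toℕ-injective (trans (sym res) (has-residue {rB} _ eq))) rA≢rB
            (there (there z∈)) → case ∈.∈-tabulate⁻ z∈ of λ where
              (j , eq) → case Fin.toℕ-injective (trans (sym res) (has-residue {j} _ eq)) of λ where
                refl → there (here eq))
          λ where
            (here refl)         → ∈⁺ (here refl) , bead-% rA _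
            (there (here refl)) → ∈⁺ (lower∈ rA) , bead-% rA _
        sort-coded .class-B   = class-unique {i = rB} p
          ((bead-mono rB (s≤s (ℕ.m≤m+n _ _)) ∷ []) ∷ [] ∷ [])
          (λ z∈ res → case ∈⁻ z∈ of λ where
            (here eq)         → contradiction
              (Fin.toℕ-injective (trans (sym (has-residue {rA} _ eq)) res)) rA≢rB
            (there (here eq)) → here eq
            (there (there z∈)) → case ∈.∈-tabulate⁻ z∈ of λ where
              (j , eq) → case Fin.toℕ-injective (trans (sym res) (has-residue {j} _ eq)) of λ where
                refl → there (here eq))
          λ where
            (here refl)         → ∈⁺ (there (here refl)) , bead-% rB _
            (there (here refl)) → ∈⁺ (lower∈ rB) , bead-% rB _
        sort-coded .class-i i i≢rA i≢rB = class-unique {i = i} p ([] ∷ [])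
          (λ z∈ res → case ∈⁻ z∈ of λ where
            (here eq)         → contradiction
              (Fin.toℕ-injective (trans (sym res) (has-residue {rA} _ eq))) i≢rA
            (there (here eq)) → contradiction
              (Fin.toℕ-injective (trans (sym res) (has-residue {rB} _ eq))) i≢rB
            (there (there z∈)) → case ∈.∈-tabulate⁻ z∈ of λ where
              (j , eq) → case Fin.toℕ-injective (trans (sym res) (has-residue {j} _ eq)) of λ where
                refl → here eq)
          λ where
            (here refl) → ∈⁺ (lower∈ i) , bead-% i _

    coded-exists : ∃ λ ν → Coded rA rB kA kB x ν × sum (toBeta (toList ν)) ≡ sum beads
    coded-exists =
      let ν , p , ν≡ = toBeta-surjective (t + 2) (≥-Sort.sort beads)
            (trans (↭.↭-length (≥-Sort.sort-↭ beads))
              (trans (cong (λ n → suc (suc n)) (List.length-tabulate _)) (ℕ.+-comm 2 t)))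
            (sort-descending beads-unique)
      in ν , sort-coded p ν≡ , trans (cong sum ν≡) (sum-↭ (≥-Sort.sort-↭ beads))

  core-size : ∀ {rA rB} → rA Fin.< rB →
    t + toℕ rB + (t + toℕ rA + sum (downFrom t)) ≡ κ t rA rB + sum (downFrom (t + 2))
  core-size {rA} {rB} rA<rB = sum-fromBeta
    (trans (cong (λ n → suc (suc n)) (List.length-applyDownFrom id t)) (ℕ.+-comm 2 t))
    (ℕ.+-monoʳ-< t rA<rB ∷ downFrom-linked t (ℕ.m≤m+n t (toℕ rA)))

  -- By `coded-unique` the partition is the one constructed from its own code, so its beta sum can
  -- be taken over the unsorted `beads`. Setting all levels and both differences to 0 there gives
  -- the beta set of the core; each further step up a class adds t.
  coded-size : ∀ {rA rB kA kB x ν} → Coded rA rB kA kB x ν →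
    ∣ ν ∣ₚ ≡ κ t rA rB + (x rA + kA + (x rB + kB) + sum (tabulate x)) * t
  coded-size {rA} {rB} {kA} {kB} {x} {ν} C
    with μ , C′ , size ← coded-exists (rA<rB C) kA kB x
    with refl ← coded-unique C C′
    = ℕ.+-cancelʳ-≡ (sum (downFrom (t + 2))) _ _ (begin
      ∣ ν ∣ₚ + sum (downFrom (t + 2))
        ≡⟨ size-beta ν ⟨
      sum (toBeta (toList ν))
        ≡⟨ size ⟩
      sum (beads (rA<rB C) kA kB x)
        ≡⟨ cong₂ (λ a b → a + (b + sum (tabulate (λ i → bead i (x i)))))
             (bead-def rA _) (bead-def rB _) ⟩
      toℕ rA + suc (x rA + kA) * t + (toℕ rB + suc (x rB + kB) * t + sum (tabulate (λ i → bead i (x i))))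
        ≡⟨ cong (λ s → toℕ rA + suc (x rA + kA) * t + (toℕ rB + suc (x rB + kB) * t + s))
             (trans (trans (cong sum (List.tabulate-cong λ i → bead-def i (x i)))
               (sum-tabulate-affine t toℕ x t))
               (cong (λ s → s + sum (tabulate x) * t) (sum-toℕ t))) ⟩
      toℕ rA + suc (x rA + kA) * t + (toℕ rB + suc (x rB + kB) * t + (sum (downFrom t) + sum (tabulate x) * t))
        ≡⟨ regroup (toℕ rA) (toℕ rB) (x rA + kA) (x rB + kB) t (sum (downFrom t)) (sum (tabulate x)) ⟩
      t + toℕ rB + (t + toℕ rA + sum (downFrom t)) + (x rA + kA + (x rB + kB) + sum (tabulate x)) * t
        ≡⟨ cong (λ s → s + (x rA + kA + (x rB + kB) + sum (tabulate x)) * t) (core-size (rA<rB C)) ⟩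
      κ t rA rB + sum (downFrom (t + 2)) + (x rA + kA + (x rB + kB) + sum (tabulate x)) * t
        ≡⟨ swap (κ t rA rB) _ _ ⟩
      κ t rA rB + (x rA + kA + (x rB + kB) + sum (tabulate x)) * t + sum (downFrom (t + 2)) ∎)
    where
    open ≡-Reasoning
    regroup : ∀ a b p q t D s →
      a + suc p * t + (b + suc q * t + (D + s * t)) ≡ t + b + (t + a + D) + (p + q + s) * t
    regroup = ℕ-Ring.solve-∀
    swap : ∀ a b c → a + b + c ≡ a + c + b
    swap = ℕ-Ring.solve-∀

-- The integers inside ℚ

ι : ℤ → ℚ
ι z = z / 1

-- The quotient `z / 1` is normalised by a gcd that does not reduce for a variable `z`; with the
-- reduced form exhibited, sums and products compute.
ι-mkℚ : ∀ z → ι z ≡ ℚ.mkℚ z 0 (C.sym (C.1-coprimeTo ℤ.∣ z ∣))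
ι-mkℚ z = ℚ.↥p/↧p≡p (ℚ.mkℚ z 0 _)

ι-+ : ∀ a b → ι (a ℤ.+ b) ≡ ι a ℚ.+ ι b
ι-+ a b rewrite ι-mkℚ a | ι-mkℚ b =
  cong ι (sym (cong₂ ℤ._+_ (ℤ.*-identityʳ a) (ℤ.*-identityʳ b)))

ι-* : ∀ a b → ι (a ℤ.* b) ≡ ι a ℚ.* ι b
ι-* a b rewrite ι-mkℚ a | ι-mkℚ b = refl

ι-neg : ∀ a → ι (ℤ.- a) ≡ ℚ.- ι a
ι-neg (+ zero)   = refl
ι-neg (+ suc n)  = refl
ι-neg ℤ.-[1+ n ] = sym (⁻¹-involutive (ι (+ suc n)))
  where open import Algebra.Properties.Group ℚ.+-0-group using (⁻¹-involutive)

ι-numerator : ∀ z → ↥ ι z ≡ z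
ι-numerator z = cong ↥_ (ι-mkℚ z)

ι-injective : ∀ {a b} → ι a ≡ ι b → a ≡ b
ι-injective {a} {b} eq = trans (sym (ι-numerator a)) (trans (cong ↥_ eq) (ι-numerator b))

ι-denominator : ∀ z → ↧ₙ (ι z) ≡ 1
ι-denominator z = cong ↧ₙ_ (ι-mkℚ z)

integral⇒ι : ∀ q → ↧ₙ q ≡ 1 → q ≡ ι (↥ q)
integral⇒ι q eq = trans (sym (ℚ.↥p/↧p≡p q)) (ℚ./-cong {p₁ = ↥ q} refl eq)

-- In unnormalised fractions no gcd occurs, and the claim is a cross-multiplication.
/-*-cancel : ∀ a n .{{_ : NonZero n}} → (a / n) ℚ.* ι (+ n) ≡ ι a
/-*-cancel a n@(suc m) = ℚ.toℚᵘ-injective (begin-equality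
  ℚ.toℚᵘ ((a / n) ℚ.* ι (+ n))              ≃⟨ ℚ.toℚᵘ-homo-* (a / n) (ι (+ n)) ⟩
  ℚ.toℚᵘ (a / n) ℚᵘ.* ℚ.toℚᵘ (ι (+ n))      ≃⟨ ℚᵘ.*-cong (ℚ.toℚᵘ-fromℚᵘ (ℚᵘ.mkℚᵘ a m)) (ℚ.toℚᵘ-fromℚᵘ (ℚᵘ.mkℚᵘ (+ n) 0)) ⟩
  ℚᵘ.mkℚᵘ a m ℚᵘ.* ℚᵘ.mkℚᵘ (+ n) 0          ≃⟨ ℚᵘ.*≡* (trans (ℤ.*-identityʳ _) (cong (λ d → a ℤ.* + d) (sym (ℕ.*-identityʳ n)))) ⟩
  ℚᵘ.mkℚᵘ a 0                               ≃⟨ ℚ.toℚᵘ-fromℚᵘ (ℚᵘ.mkℚᵘ a 0) ⟨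
  ℚ.toℚᵘ (ι a)                              ∎)
  where open ℚᵘ.≤-Reasoning

*-cancelʳ-≢0 : ∀ {p q} s → s ≢ 0ℚ → p ℚ.* s ≡ q ℚ.* s → p ≡ q
*-cancelʳ-≢0 {p} {q} s s≢0 eq = trans (sym (undo p)) (trans (cong (ℚ._* (ℚ.1/ s)) eq) (undo q))
  where
  instance _ = ℚ.≢-nonZero s≢0
  undo : ∀ r → r ℚ.* s ℚ.* (ℚ.1/ s) ≡ r
  undo r = trans (ℚ.*-assoc r s _) (trans (cong (r ℚ.*_) (ℚ.*-inverseʳ s)) (ℚ.*-identityʳ r))

∣m⊖n∣≡∣m-n∣ : ∀ m n → ℤ.∣ m ℤ.⊖ n ∣ ≡ ∣ m - n ∣
∣m⊖n∣≡∣m-n∣ zero    zero    = refl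
∣m⊖n∣≡∣m-n∣ zero    (suc n) = refl
∣m⊖n∣≡∣m-n∣ (suc m) zero    = refl
∣m⊖n∣≡∣m-n∣ (suc m) (suc n) = trans (cong ℤ.∣_∣ (ℤ.[1+m]⊖[1+n]≡m⊖n m n)) (∣m⊖n∣≡∣m-n∣ m n)

module _ (t : ℕ) .{{_ : NonZero t}} where

  private
    t≢0 : t ≢ 0
    t≢0 = ℕ.≢-nonZero⁻¹ t

  -- Interval triples in terms of the encoding

  pair-sum : Fin t → ℕ → ℕ → ℕ
  pair-sum i v k = bead t i (suc (v + k)) + bead t i v

  bead-gap : ∀ i v k → bead t i (suc (v + k)) ∸ bead t i v ≡ suc k * t
  bead-gap i v k = begin
    bead t i (suc (v + k)) ∸ bead t i v  ≡⟨ cong₂ _∸_ (bead-def t i _) (bead-def t i v) ⟩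
    toℕ i + suc (v + k) * t ∸ b          ≡⟨ cong (_∸ b) (regroup (toℕ i) v k t) ⟩
    suc k * t + b ∸ b                    ≡⟨ ℕ.m+n∸n≡m (suc k * t) b ⟩
    suc k * t                            ∎
    where
    open ≡-Reasoning
    b = toℕ i + v * t
    regroup : ∀ i v k t → i + suc (v + k) * t ≡ suc k * t + (i + v * t)
    regroup = ℕ-Ring.solve-∀

  triple⇒coded : ∀ {ν d₁ d₂ d₃} → IsPartition ν → IntervalTriple t ν d₁ d₂ d₃ →
    ∃₂ λ rA rB → ∃₂ λ kA kB → ∃ λ x → Coded t rA rB kA kB x ν ×
      d₁ ≡ suc kA * t × d₂ ≡ suc kB * t ×
      d₃ ≡ ∣ pair-sum rA (x rA) kA - pair-sum rB (x rB) kB ∣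
  triple⇒coded {ν} p I
    with kA , kB , x , C ← decode t {ν} p (IntervalTriple.distinguished I)
    with refl ← trans (sym (IntervalTriple.class-A I)) (Coded.class-A C)
    with refl ← trans (sym (IntervalTriple.class-B I)) (Coded.class-B C)
    = rA , rB , kA , kB , x , C ,
      trans d₁-def (bead-gap rA (x rA) kA) , trans d₂-def (bead-gap rB (x rB) kB) , d₃-def
    where open IntervalTriple I

  coded⇒triple : ∀ {rA rB kA kB x ν} → Coded t rA rB kA kB x ν →
    IntervalTriple t ν (suc kA * t) (suc kB * t)
      ∣ pair-sum rA (x rA) kA - pair-sum rB (x rB) kB ∣
  coded⇒triple {rA} {rB} {kA} {kB} {x} C = record
    { distinguished = coded⇒distinguished t C
    ; class-A = Coded.class-A C
    ; class-B = Coded.class-B C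
    ; d₁-def  = sym (bead-gap rA (x rA) kA)
    ; d₂-def  = sym (bead-gap rB (x rB) kB)
    ; d₃-def  = refl
    }

  coded⇒𝒯 : ∀ {rA rB kA kB x ν} → Coded t rA rB kA kB x ν → 𝒯 t ν
  coded⇒𝒯 C = Coded.partition C , _ , _ , coded⇒distinguished t C

  -- The signed form of d₃; the sign forgotten by the absolute value is the η of a label.
  gap : (rA rB : Fin t) (kA kB : ℕ) (v w : ℕ) → ℤ
  gap rA rB kA kB v w = + pair-sum rA v kA ℤ.- + pair-sum rB w kB

  ∣gap∣ : ∀ rA rB kA kB v w → ℤ.∣ gap rA rB kA kB v w ∣ ≡ ∣ pair-sum rA v kA - pair-sum rB w kB ∣
  ∣gap∣ rA rB kA kB v w = trans
    (cong ℤ.∣_∣ (ℤ.m-n≡m⊖n (pair-sum rA v kA) (pair-sum rB w kB)))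
    (∣m⊖n∣≡∣m-n∣ (pair-sum rA v kA) (pair-sum rB w kB))

  -- The gap is linear in v - w; branches are the solutions of
  -- gap = η d₃ for v - w.

  offset : (rA rB : Fin t) (kA kB : ℕ) → ℤ
  offset rA rB kA kB =
    + 2 ℤ.* (+ toℕ rA ℤ.- + toℕ rB) ℤ.+ + kA ℤ.* + t ℤ.- + kB ℤ.* + t

  gap-linear : ∀ rA rB kA kB v w →
    gap rA rB kA kB v w ≡ (+ v ℤ.- + w) ℤ.* (+ 2 ℤ.* + t) ℤ.+ offset rA rB kA kB
  gap-linear rA rB kA kB v w = begin
    gap rA rB kA kB v w
      ≡⟨ cong₂ ℤ._-_ (cast rA v kA) (cast rB w kB) ⟩
    toℤ rA v kA ℤ.- toℤ rB w kB
      ≡⟨ regroup (+ toℕ rA) (+ toℕ rB) (+ kA) (+ kB) (+ v) (+ w) (+ t) ⟩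
    (+ v ℤ.- + w) ℤ.* (+ 2 ℤ.* + t) ℤ.+ offset rA rB kA kB ∎
    where
    open ≡-Reasoning
    toℤ : Fin t → ℕ → ℕ → ℤ
    toℤ i v k = + toℕ i ℤ.+ (1ℤ ℤ.+ (+ v ℤ.+ + k)) ℤ.* + t ℤ.+ (+ toℕ i ℤ.+ + v ℤ.* + t)

    cast : ∀ i v k → + pair-sum i v k ≡ toℤ i v k
    cast i v k = trans
      (cong₂ (λ a b → + (a + b)) (bead-def t i _) (bead-def t i v))
      (cong₂ (λ a b → + toℕ i ℤ.+ a ℤ.+ (+ toℕ i ℤ.+ b))
        (ℤ.pos-* (suc (v + k)) t) (ℤ.pos-* v t))

    regroup : ∀ a b k l v w t →
      (a ℤ.+ (1ℤ ℤ.+ (v ℤ.+ k)) ℤ.* t ℤ.+ (a ℤ.+ v ℤ.* t)) ℤ.-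
      (b ℤ.+ (1ℤ ℤ.+ (w ℤ.+ l)) ℤ.* t ℤ.+ (b ℤ.+ w ℤ.* t))
      ≡ (v ℤ.- w) ℤ.* (+ 2 ℤ.* t) ℤ.+ (+ 2 ℤ.* (a ℤ.- b) ℤ.+ k ℤ.* t ℤ.- l ℤ.* t)
    regroup = ℤ-Ring.solve-∀

  module _ (d₃ kA kB : ℕ) where

    private
      c′ : Label t → ℤ
      c′ = c t d₃ kA kB

    -- The formula for c multiplied by 2t and rearranged, so that only integers remain.
    Solution : Label t → ℤ → Set
    Solution (rA , rB , η) z = z ℤ.* (+ 2 ℤ.* + t) ℤ.+ offset rA rB kA kB ≡ η ◃ d₃

    c-value-scaled : ∀ rA rB η → c-value t d₃ kA kB (rA , rB , η) ℚ.* ι (+ 2 ℤ.* + t)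
                     ≡ ι ((η ◃ d₃) ℤ.- offset rA rB kA kB)
    c-value-scaled rA rB η = begin
      ½ ℚ.* (y ℚ.- a ℚ.+ b) ℚ.* ι (+ 2 ℤ.* + t)
        ≡⟨ cong (½ ℚ.* (y ℚ.- a ℚ.+ b) ℚ.*_) (ι-* (+ 2) (+ t)) ⟩
      ½ ℚ.* (y ℚ.- a ℚ.+ b) ℚ.* (ι (+ 2) ℚ.* τ)
        ≡⟨ solve 5 (λ h y a b s → h :* (y :- a :+ b) :* (con (ι (+ 2)) :* s)
             := (h :* con (ι (+ 2))) :* (y :* s :- a :* s :+ b :* s)) refl ½ y a b τ ⟩
      1ℚ ℚ.* (y ℚ.* τ ℚ.- a ℚ.* τ ℚ.+ b ℚ.* τ)
        ≡⟨ ℚ.*-identityˡ _ ⟩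
      y ℚ.* τ ℚ.- a ℚ.* τ ℚ.+ b ℚ.* τ
        ≡⟨ cong₂ ℚ._+_ (cong₂ ℚ._-_ (/-*-cancel Y t) (sym (ι-* (+ kA) (+ t)))) (sym (ι-* (+ kB) (+ t))) ⟩
      ι Y ℚ.- ι (+ kA ℤ.* + t) ℚ.+ ι (+ kB ℤ.* + t)
        ≡⟨ cong (λ z → ι Y ℚ.+ z ℚ.+ ι (+ kB ℤ.* + t)) (sym (ι-neg (+ kA ℤ.* + t))) ⟩
      ι Y ℚ.+ ι (ℤ.- (+ kA ℤ.* + t)) ℚ.+ ι (+ kB ℤ.* + t)
        ≡⟨ cong (ℚ._+ ι (+ kB ℤ.* + t)) (sym (ι-+ Y _)) ⟩
      ι (Y ℤ.- + kA ℤ.* + t) ℚ.+ ι (+ kB ℤ.* + t)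
        ≡⟨ ι-+ (Y ℤ.- + kA ℤ.* + t) (+ kB ℤ.* + t) ⟨
      ι (Y ℤ.- + kA ℤ.* + t ℤ.+ + kB ℤ.* + t)
        ≡⟨ cong ι (regroup (η ◃ d₃) (+ toℕ rA ℤ.- + toℕ rB) (+ kA ℤ.* + t) (+ kB ℤ.* + t)) ⟩
      ι ((η ◃ d₃) ℤ.- offset rA rB kA kB) ∎
      where
      open ≡-Reasoning
      open ℚ-Solver.+-*-Solver
      Y = (η ◃ d₃) ℤ.- (+ 2) ℤ.* (+ toℕ rA ℤ.- + toℕ rB)
      y = Y / t
      a = ι (+ kA)
      b = ι (+ kB)
      τ = ι (+ t)
      regroup : ∀ d r k l → d ℤ.- + 2 ℤ.* r ℤ.- k ℤ.+ l ≡ d ℤ.- (+ 2 ℤ.* r ℤ.+ k ℤ.- l)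
      regroup = ℤ-Ring.solve-∀

    scale≢0 : ι (+ 2 ℤ.* + t) ≢ 0ℚ
    scale≢0 eq with ℤ.i*j≡0⇒i≡0∨j≡0 (+ 2) (ι-injective eq)
    ... | inj₂ t≡0 = t≢0 (ℤ.+-injective t≡0)

    -- Multiplied by 2t, both the rational c and the integer `z` become η d₃ minus the offset. As 2t
    -- is nonzero they coincide, and denominator and numerator can be read off from `z`.
    solution⇒integral : ∀ ℓ z → Solution ℓ z → ↧ₙ (c-value t d₃ kA kB ℓ) ≡ 1 × c′ ℓ ≡ z
    solution⇒integral ℓ@(rA , rB , η) z eq =
      trans (cong ↧ₙ_ value≡z) (ι-denominator z) , trans (cong ↥_ value≡z) (ι-numerator z)
      where
      value≡z : c-value t d₃ kA kB ℓ ≡ ι z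
      value≡z = *-cancelʳ-≢0 (ι (+ 2 ℤ.* + t)) scale≢0
        (trans (c-value-scaled rA rB η)
        (trans (cong ι (trans (cong (ℤ._- offset rA rB kA kB) (sym eq)) (cancel (z ℤ.* (+ 2 ℤ.* + t)) (offset rA rB kA kB))))
        (ι-* z (+ 2 ℤ.* + t))))
        where
        cancel : ∀ a b → a ℤ.+ b ℤ.- b ≡ a
        cancel = ℤ-Ring.solve-∀

    integral⇒solution : ∀ ℓ → ↧ₙ (c-value t d₃ kA kB ℓ) ≡ 1 → Solution ℓ (c′ ℓ)
    integral⇒solution ℓ@(rA , rB , η) den≡1 = trans
      (cong (ℤ._+ offset rA rB kA kB) (ι-injective {c′ ℓ ℤ.* (+ 2 ℤ.* + t)} {(η ◃ d₃) ℤ.- offset rA rB kA kB} (begin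
        ι (c′ ℓ ℤ.* (+ 2 ℤ.* + t))              ≡⟨ ι-* (c′ ℓ) (+ 2 ℤ.* + t) ⟩
        ι (c′ ℓ) ℚ.* ι (+ 2 ℤ.* + t)            ≡⟨ cong (ℚ._* ι (+ 2 ℤ.* + t)) (integral⇒ι (c-value t d₃ kA kB ℓ) den≡1) ⟨
        c-value t d₃ kA kB ℓ ℚ.* ι (+ 2 ℤ.* + t) ≡⟨ c-value-scaled rA rB η ⟩
        ι ((η ◃ d₃) ℤ.- offset rA rB kA kB)      ∎)))
      (cancel (η ◃ d₃) (offset rA rB kA kB))
      where
      open ≡-Reasoning
      cancel : ∀ a b → a ℤ.- b ℤ.+ b ≡ a
      cancel = ℤ-Ring.solve-∀

    gap⇒branch : ∀ {rA rB η v w} → rA Fin.< rB → gap rA rB kA kB v w ≡ η ◃ d₃ →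
      IsBranch t d₃ kA kB (rA , rB , η) × c′ (rA , rB , η) ≡ + v ℤ.- + w
    gap⇒branch {rA} {rB} {η} {v} {w} A<B eq =
      let den , c≡ = solution⇒integral (rA , rB , η) (+ v ℤ.- + w)
                       (trans (sym (gap-linear rA rB kA kB v w)) eq)
      in (A<B , den) , c≡

    branch⇒gap : ∀ {rA rB η v w} → IsBranch t d₃ kA kB (rA , rB , η) →
      c′ (rA , rB , η) ≡ + v ℤ.- + w → gap rA rB kA kB v w ≡ η ◃ d₃
    branch⇒gap {rA} {rB} {η} {v} {w} (_ , den) c≡ = trans (gap-linear rA rB kA kB v w)
      (subst (Solution (rA , rB , η)) c≡ (integral⇒solution (rA , rB , η) den))

-- Fibres and branches

module _ (t : ℕ) .{{_ : NonZero t}} (d₃ kA kB : ℕ) where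

  private
    c′ : Label t → ℤ
    c′ = c t d₃ kA kB

    Fib : Vec ℕ (t + 2) → Set
    Fib = Fibre t (suc kA * t) (suc kB * t) d₃

    Br : Label t → Vec ℕ (t + 2) → Set
    Br = Branch t d₃ kA kB

    IsBr : Label t → Set
    IsBr = IsBranch t d₃ kA kB

    Code : Fin t → Fin t → (Fin t → ℕ) → Vec ℕ (t + 2) → Set
    Code rA rB = Coded t rA rB kA kB

  fibre⇒coded : ∀ {ν} → Fib ν → ∃₂ λ rA rB → ∃ λ x → Code rA rB x ν ×
                d₃ ≡ ∣ pair-sum t rA (x rA) kA - pair-sum t rB (x rB) kB ∣
  fibre⇒coded ((p , _) , I) with rA , rB , kA′ , kB′ , x , C , d₁≡ , d₂≡ , d₃≡ ← triple⇒coded t p I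
    with refl ← ℕ.suc-injective (ℕ.*-cancelʳ-≡ (suc kA) (suc kA′) t d₁≡)
    with refl ← ℕ.suc-injective (ℕ.*-cancelʳ-≡ (suc kB) (suc kB′) t d₂≡)
    = rA , rB , x , C , d₃≡

  coded⇒fibre : ∀ {ν rA rB x} → Code rA rB x ν →
    d₃ ≡ ∣ pair-sum t rA (x rA) kA - pair-sum t rB (x rB) kB ∣ → Fib ν
  coded⇒fibre C refl = coded⇒𝒯 t C , coded⇒triple t C

  -- Decoding yields differences of its own, `kA′` and `kB′`. Comparing the quotients entry by entry
  -- shows that v and v - c are the two lowest levels, after which the upper entries force `kA′` and
  -- `kB′` to be `kA` and `kB`.
  branchPoint⇒coded : ∀ {rA rB η v m ν} → BranchPoint t d₃ kA kB (rA , rB , η) v m ν →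
    ∃ λ x → Code rA rB x ν × v ≡ + x rA × c′ (rA , rB , η) ≡ + x rA ℤ.- + x rB ×
            (∀ i i≢ i≢′ → m i i≢ i≢′ ≡ x i)
  branchPoint⇒coded {rA} {rB} {η} {v} {m} P
    with kA′ , kB′ , x , C ← decode t (BranchPoint.partition P) (BranchPoint.distinguished P)
    = x , code , v≡ , c≡ , m≡
    where
    eqA = trans (sym (cong (map pos) (coded-quotient-A t C))) (BranchPoint.quotient-A P)
    eqB = trans (sym (cong (map pos) (coded-quotient-B t C))) (BranchPoint.quotient-B P)

    v≡ : v ≡ + x rA
    v≡ = sym (List.∷-injectiveˡ (List.∷-injectiveʳ eqA))

    w≡ : v ℤ.- c′ (rA , rB , η) ≡ + x rB
    w≡ = sym (List.∷-injectiveˡ (List.∷-injectiveʳ eqB))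

    c≡ : c′ (rA , rB , η) ≡ + x rA ℤ.- + x rB
    c≡ = trans (flip v (c′ (rA , rB , η))) (cong₂ ℤ._-_ v≡ w≡)
      where
      flip : ∀ a b → b ≡ a ℤ.- (a ℤ.- b)
      flip = ℤ-Ring.solve-∀

    upper : ∀ {y k k′ u} → + (y + k′) ≡ u ℤ.+ + k → u ≡ + y → k′ ≡ k
    upper {y} eq refl = ℕ.+-cancelˡ-≡ y _ _ (ℤ.+-injective eq)

    code : Code rA rB x _
    code with refl ← upper {x rA} (List.∷-injectiveˡ eqA) v≡ | refl ← upper {x rB} (List.∷-injectiveˡ eqB) w≡ = C

    m≡ : ∀ i i≢ i≢′ → m i i≢ i≢′ ≡ x i
    m≡ i i≢ i≢′ = List.∷-injectiveˡ
      (trans (sym (BranchPoint.quotient-i P i i≢ i≢′)) (coded-quotient-i t C i i≢ i≢′))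

  coded⇒branchPoint : ∀ {rA rB η v m x ν} → Code rA rB x ν →
    v ≡ + x rA → c′ (rA , rB , η) ≡ + x rA ℤ.- + x rB → (∀ i i≢ i≢′ → m i i≢ i≢′ ≡ x i) →
    BranchPoint t d₃ kA kB (rA , rB , η) v m ν
  coded⇒branchPoint {rA} {rB} {η} {x = x} C refl c≡ m≡ = record
    { partition     = Coded.partition C
    ; distinguished = coded⇒distinguished t C
    ; quotient-A    = cong (map pos) (coded-quotient-A t C)
    ; quotient-B    = trans (cong (map pos) (coded-quotient-B t C))
        (cong (λ w → (w ℤ.+ + kB) ∷ w ∷ []) (sym w≡))
    ; quotient-i    = λ i i≢ i≢′ →
        trans (coded-quotient-i t C i i≢ i≢′) (cong (_∷ []) (sym (m≡ i i≢ i≢′)))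
    }
    where
    flip : ∀ a b → a ℤ.- (a ℤ.- b) ≡ b
    flip = ℤ-Ring.solve-∀
    w≡ : + x rA ℤ.- c′ (rA , rB , η) ≡ + x rB
    w≡ = trans (cong (λ z → + x rA ℤ.- z) c≡) (flip (+ x rA) (+ x rB))

  -- With v = `x rA` and v - c = `x rB`, the bound v ≥ max(0, c) says that both levels are
  -- nonnegative, which holds for natural numbers automatically.
  branch⇔coded : ∀ {rA rB η ν} → Br (rA , rB , η) ν ⇔
    (∃ λ x → Code rA rB x ν × c′ (rA , rB , η) ≡ + x rA ℤ.- + x rB)
  branch⇔coded {rA} {rB} {η} {ν} = mk⇔
    (λ (v , _ , m , P) → case branchPoint⇒coded P of λ (x , C , _ , c≡ , _) → x , C , c≡)
    (λ (x , C , c≡) → + x rA , bound x c≡ , (λ i _ _ → x i) ,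
      coded⇒branchPoint C refl c≡ (λ _ _ _ → refl))
    where
    bound : ∀ x → c′ (rA , rB , η) ≡ + x rA ℤ.- + x rB → 0ℤ ℤ.⊔ c′ (rA , rB , η) ℤ.≤ + x rA
    bound x c≡ = ℤ.⊔-lub (ℤ.+≤+ z≤n)
      (ℤ.≤-trans (ℤ.≤-reflexive c≡) (ℤ.i-j≤i (+ x rA) (+ x rB)))

  fibre⇒branch : ∀ {ν} → Fib ν → ∃ λ ℓ → IsBr ℓ × Br ℓ ν
  fibre⇒branch fib with rA , rB , x , C , d₃≡ ← fibre⇒coded fib =
    (rA , rB , η) , proj₁ isBranch ,
    ⇔-from (branch⇔coded {rA} {rB} {η}) (x , C , proj₂ isBranch)
    where
    g = gap t rA rB kA kB (x rA) (x rB)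
    -- The sign is forced unless the gap is 0, and then this choice is +.
    η = ℤ.sign g

    gap≡ : g ≡ η ◃ d₃
    gap≡ = trans (sym (ℤ.signᵢ◃∣i∣≡i g))
      (cong (η ◃_) (trans (∣gap∣ t rA rB kA kB (x rA) (x rB)) (sym d₃≡)))

    isBranch = gap⇒branch t d₃ kA kB {rA} {rB} {η} {x rA} {x rB} (Coded.rA<rB C) gap≡

  signed-gap-unique : ∀ {η η′ g} → g ≡ η ◃ d₃ → g ≡ η′ ◃ d₃ → η ≡ η′ ⊎ d₃ ≡ 0
  signed-gap-unique {η} {η′} eq eq′ =
    Sum.map₂ proj₁ (ℤ.sign-cong′ {η} {d₃} {η′} {d₃} (trans (sym eq) eq′))

  branch-gap : ∀ {rA rB η ν} → IsBr (rA , rB , η) → Br (rA , rB , η) ν →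
    ∃ λ x → Code rA rB x ν × gap t rA rB kA kB (x rA) (x rB) ≡ η ◃ d₃
  branch-gap {rA} {rB} {η} isBranch br = let x , C , c≡ = ⇔-to (branch⇔coded {rA} {rB} {η}) br in
    x , C , branch⇒gap t d₃ kA kB {rA} {rB} {η} {x rA} {x rB} isBranch c≡

  gap⇒fibre : ∀ {rA rB η x ν} → Code rA rB x ν →
    gap t rA rB kA kB (x rA) (x rB) ≡ η ◃ d₃ → Fib ν
  gap⇒fibre {rA} {rB} {η} {x} C eq = coded⇒fibre C (trans (sym (ℤ.abs-◃ η d₃))
    (trans (cong ℤ.∣_∣ (sym eq)) (∣gap∣ t rA rB kA kB (x rA) (x rB))))

  branch⇒fibre : ∀ {rA rB η ν} → IsBr (rA , rB , η) → Br (rA , rB , η) ν → Fib ν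
  branch⇒fibre {rA} {rB} {η} isBranch br = let x , C , eq = branch-gap {rA} {rB} {η} isBranch br in
    gap⇒fibre {rA} {rB} {η} {x} C eq

  fibre⇔branch : ∀ ν → Fib ν ⇔ (∃ λ ℓ → IsBr ℓ × Br ℓ ν)
  fibre⇔branch ν = mk⇔ fibre⇒branch (λ ((rA , rB , η) , isBranch , br) → branch⇒fibre {rA} {rB} {η} isBranch br)

  -- The partition determines its distinguished residues and its levels, hence the gap; the gap
  -- determines η unless it vanishes.
  codes-agree : ∀ {rA rB rA′ rB′ x y η η′ ν} → Code rA rB x ν → Code rA′ rB′ y ν →
    gap t rA rB kA kB (x rA) (x rB) ≡ η ◃ d₃ → gap t rA′ rB′ kA kB (y rA′) (y rB′) ≡ η′ ◃ d₃ →
    SameBranch d₃ (rA , rB , η) (rA′ , rB′ , η′)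
  codes-agree {rA} {rB} {η = η} {η′} C C′ eq eq′
    with refl , refl ← distinguished-unique t (coded⇒distinguished t C) (coded⇒distinguished t C′)
    = refl , refl , signed-gap-unique {η} {η′} eq
        (trans (cong₂ (gap t rA rB kA kB) (x≗y rA) (x≗y rB)) eq′)
    where x≗y = coded-x-unique t C C′

  branches-disjoint : ∀ ℓ ℓ′ → IsBr ℓ → IsBr ℓ′ → ∀ ν → Br ℓ ν → Br ℓ′ ν → SameBranch d₃ ℓ ℓ′
  branches-disjoint (rA , rB , η) (rA′ , rB′ , η′) isBr isBr′ ν br br′ =
    let x , C  , eq  = branch-gap {rA} {rB} {η} isBr br
        y , C′ , eq′ = branch-gap {rA′} {rB′} {η′} isBr′ br′
    in codes-agree {η = η} {η′} C C′ eq eq′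

  branchPoint-params-unique : ∀ ℓ v v′ m m′ ν →
    BranchPoint t d₃ kA kB ℓ v m ν → BranchPoint t d₃ kA kB ℓ v′ m′ ν →
    v ≡ v′ × (∀ i i≢rA i≢rB → m i i≢rA i≢rB ≡ m′ i i≢rA i≢rB)
  branchPoint-params-unique ℓ@(rA , rB , η) v v′ m m′ ν P P′ =
    let x , C  , v≡  , _ , m≡  = branchPoint⇒coded {rA} {rB} {η} P
        y , C′ , v′≡ , _ , m′≡ = branchPoint⇒coded {rA} {rB} {η} P′
        x≗y = coded-x-unique t C C′
    in trans v≡ (trans (cong pos (x≗y rA)) (sym v′≡)) ,
       λ i i≢ i≢′ → trans (m≡ i i≢ i≢′) (trans (x≗y i) (sym (m′≡ i i≢ i≢′)))

  module _ {rA rB : Fin t} (rA≢rB : rA ≢ rB) (v w : ℕ) (m : (i : Fin t) → i ≢ rA → i ≢ rB → ℕ) where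

    extend : Fin t → ℕ
    extend i with i Fin.≟ rA | i Fin.≟ rB
    ... | yes _  | _      = v
    ... | no  _  | yes _  = w
    ... | no  i≢ | no i≢′ = m i i≢ i≢′

    extend-A : extend rA ≡ v
    extend-A with rA Fin.≟ rA
    ... | yes _ = refl
    ... | no ≢  = contradiction refl ≢

    extend-B : extend rB ≡ w
    extend-B with rB Fin.≟ rA | rB Fin.≟ rB
    ... | yes eq | _     = contradiction (sym eq) rA≢rB
    ... | no  _  | yes _ = refl
    ... | no  _  | no ≢  = contradiction refl ≢

    extend-i : ∀ i i≢ i≢′ → m i i≢ i≢′ ≡ extend i
    extend-i i i≢ i≢′ with i Fin.≟ rA | i Fin.≟ rB
    ... | yes eq | _      = contradiction eq i≢
    ... | no  _  | yes eq = contradiction eq i≢′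
    -- The inequality proofs found by decision need not be the given ones, but proofs of a negation
    -- are definitionally equal, so `m` takes the same value on both.
    ... | no  _  | no _   = refl

    extend-unique : ∀ {y : Fin t → ℕ} → y rA ≡ v → y rB ≡ w → (∀ i i≢ i≢′ → m i i≢ i≢′ ≡ y i) →
                    ∀ i → y i ≡ extend i
    extend-unique yA yB yi i with i Fin.≟ rA | i Fin.≟ rB
    ... | yes refl | _        = yA
    ... | no  _    | yes refl = yB
    ... | no  i≢   | no i≢′   = sym (yi i i≢ i≢′)

  branchPoint-exists : ∀ ℓ → IsBr ℓ → ∀ v m → 0ℤ ℤ.⊔ c′ ℓ ℤ.≤ v →
                       ∃! _≡_ (BranchPoint t d₃ kA kB ℓ v m)
  branchPoint-exists ℓ@(rA , rB , η) isBranch v m bound =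
    proj₁ encoded , coded⇒branchPoint {rA} {rB} {η} C v≡ c≡ (extend-i A≢B a b m) , unique
    where
    A≢B : rA ≢ rB
    A≢B eq = ℕ.<-irrefl (cong toℕ eq) (proj₁ isBranch)

    -- Since v ≥ max(0, c), both v and v - c are nonnegative, so the absolute values recover them
    -- exactly.
    a = ℤ.∣ v ∣
    b = ℤ.∣ v ℤ.- c′ ℓ ∣
    x = extend A≢B a b m

    encoded = coded-exists t (proj₁ isBranch) kA kB x
    C = proj₁ (proj₂ encoded)

    +a≡v : + a ≡ v
    +a≡v = ℤ.0≤i⇒+∣i∣≡i (ℤ.≤-trans (ℤ.i≤i⊔j 0ℤ (c′ ℓ)) bound)

    +b≡v-c : + b ≡ v ℤ.- c′ ℓ
    +b≡v-c = ℤ.0≤i⇒+∣i∣≡i (ℤ.i≤j⇒0≤j-i (ℤ.≤-trans (ℤ.i≤j⊔i 0ℤ (c′ ℓ)) bound))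

    flip : ∀ a b → b ≡ a ℤ.- (a ℤ.- b)
    flip = ℤ-Ring.solve-∀

    v≡ : v ≡ + x rA
    v≡ = trans (sym +a≡v) (cong pos (sym (extend-A A≢B a b m)))

    v-c≡ : v ℤ.- c′ ℓ ≡ + x rB
    v-c≡ = trans (sym +b≡v-c) (cong pos (sym (extend-B A≢B a b m)))

    c≡ : c′ ℓ ≡ + x rA ℤ.- + x rB
    c≡ = trans (flip v (c′ ℓ)) (cong₂ ℤ._-_ v≡ v-c≡)

    unique : ∀ {μ} → BranchPoint t d₃ kA kB ℓ v m μ → proj₁ encoded ≡ μ
    unique P = let y , C′ , v≡′ , c≡′ , m≡ = branchPoint⇒coded {rA} {rB} {η} P in
      coded-unique t C (coded-cong t (extend-unique A≢B a b m {y}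
        (ℤ.+-injective (trans (sym v≡′) (sym +a≡v)))
        (ℤ.+-injective (trans (flip (+ y rA) (+ y rB))
          (trans (cong₂ ℤ._-_ (sym v≡′) (sym c≡′)) (sym +b≡v-c))))
        m≡) C′)

  -- Both signed zeros `η ◃ 0` reduce to the same integer, so the two labels have literally the same
  -- c.
  signs-agree : d₃ ≡ 0 → ∀ rA rB →
    (IsBr (rA , rB , Sign.+) ⇔ IsBr (rA , rB , Sign.-)) ×
    (∀ ν → Br (rA , rB , Sign.+) ν ⇔ Br (rA , rB , Sign.-) ν)
  signs-agree refl rA rB = mk⇔ id id , λ ν → mk⇔
    (λ br → ⇔-from branch⇔coded (⇔-to (branch⇔coded {rA} {rB} {Sign.+}) br))
    (λ br → ⇔-from branch⇔coded (⇔-to (branch⇔coded {rA} {rB} {Sign.-}) br))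

  -- Raising the level of every class by the same n changes neither the differences inside the
  -- classes nor, as it depends only on v - w, the gap.
  fibre-infinite : (∃ λ ν → Fib ν) → Infinite Fib
  fibre-infinite (ν , fib) with rA , rB , x , C , d₃≡ ← fibre⇒coded fib =
    proj₁ ∘ lift , injective , λ n → coded⇒fibre (proj₁ (proj₂ (lift n))) (gap-const n)
    where
    lift : ∀ n → _
    lift n = coded-exists t (Coded.rA<rB C) kA kB (λ i → n + x i)

    injective : ∀ {n n′} → proj₁ (lift n) ≡ proj₁ (lift n′) → n ≡ n′
    injective {n} {n′} eq = ℕ.+-cancelʳ-≡ (x rA) n n′
      (coded-x-unique t (proj₁ (proj₂ (lift n)))
        (subst (Code rA rB (λ i → n′ + x i)) (sym eq) (proj₁ (proj₂ (lift n′)))) rA)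

    shift-gap : ∀ n → gap t rA rB kA kB (n + x rA) (n + x rB) ≡ gap t rA rB kA kB (x rA) (x rB)
    shift-gap n = trans (gap-linear t rA rB kA kB _ _) (trans
      (cong (λ z → z ℤ.* (+ 2 ℤ.* + t) ℤ.+ offset t rA rB kA kB) (cancel (+ n) (+ x rA) (+ x rB)))
      (sym (gap-linear t rA rB kA kB _ _)))
      where
      cancel : ∀ n a b → (n ℤ.+ a) ℤ.- (n ℤ.+ b) ≡ a ℤ.- b
      cancel = ℤ-Ring.solve-∀

    gap-const : ∀ n → d₃ ≡ ∣ pair-sum t rA (n + x rA) kA - pair-sum t rB (n + x rB) kB ∣
    gap-const n = begin
      d₃                                                                 ≡⟨ d₃≡ ⟩
      ∣ pair-sum t rA (x rA) kA - pair-sum t rB (x rB) kB ∣              ≡⟨ ∣gap∣ t rA rB kA kB _ _ ⟨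
      ℤ.∣ gap t rA rB kA kB (x rA) (x rB) ∣                              ≡⟨ cong ℤ.∣_∣ (shift-gap n) ⟨
      ℤ.∣ gap t rA rB kA kB (n + x rA) (n + x rB) ∣                      ≡⟨ ∣gap∣ t rA rB kA kB _ _ ⟩
      ∣ pair-sum t rA (n + x rA) kA - pair-sum t rB (n + x rB) kB ∣      ∎
      where open ≡-Reasoning

-- Cardinalities

module _ {A : Set} where

  card-⇔ : ∀ {P Q : Pred A 0ℓ} {k} → (∀ x → P x ⇔ Q x) → HasCardinality P k → HasCardinality Q k
  card-⇔ P⇔Q (xs , u , ∈⇔ , len) = xs , u ,
    (λ x → mk⇔ (⇔-to (P⇔Q x) ∘ ⇔-to (∈⇔ x)) (⇔-from (∈⇔ x) ∘ ⇔-from (P⇔Q x))) , len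

  card-∅ : ∀ {P : Pred A 0ℓ} → (∀ x → ¬ P x) → HasCardinality P 0
  card-∅ ¬P = [] , [] , (λ x → mk⇔ (λ ()) (⊥-elim ∘ ¬P x)) , refl

  card-singleton : ∀ (a : A) → HasCardinality (_≡ a) 1
  card-singleton a = a ∷ [] , ([] ∷ []) , (λ x → mk⇔ (λ { (here eq) → eq ; (there ()) }) here) , refl

  card-⊎ : ∀ {P Q : Pred A 0ℓ} {m n} → (∀ x → P x → ¬ Q x) →
           HasCardinality P m → HasCardinality Q n → HasCardinality (λ x → P x ⊎ Q x) (m + n)
  card-⊎ disjoint (xs , uxs , ∈xs , lxs) (ys , uys , ∈ys , lys) =
    xs ++ ys ,
    Unique.++⁺ uxs uys (λ (x∈ , y∈) → disjoint _ (⇔-to (∈xs _) x∈) (⇔-to (∈ys _) y∈)) ,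
    (λ x → mk⇔ (Sum.map (⇔-to (∈xs x)) (⇔-to (∈ys x)) ∘ ∈.∈-++⁻ xs)
      Sum.[ ∈.∈-++⁺ˡ ∘ ⇔-from (∈xs x) , ∈.∈-++⁺ʳ xs ∘ ⇔-from (∈ys x) ]) ,
    trans (List.length-++ xs) (cong₂ _+_ lxs lys)

  card-image : ∀ {B : Set} {P : Pred A 0ℓ} {k} (f : A → B) → (∀ {x y} → f x ≡ f y → x ≡ y) →
               HasCardinality P k → HasCardinality (λ y → ∃ λ x → P x × y ≡ f x) k
  card-image f inj (xs , u , ∈⇔ , len) = map f xs , Unique.map⁺ inj u ,
    (λ y → mk⇔
      (λ y∈ → let x , x∈ , eq = ∈.∈-map⁻ f y∈ in x , ⇔-to (∈⇔ x) x∈ , eq)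
      λ (x , Px , eq) → subst (_∈ map f xs) (sym eq) (∈.∈-map⁺ f (⇔-from (∈⇔ x) Px))) ,
    trans (List.length-map f xs) len

  card-⋃ : ∀ {L : Set} (P : L → Pred A 0ℓ) (N : L → ℕ) (ls : List L) → Unique ls →
    (∀ {l} → l ∈ ls → HasCardinality (P l) (N l)) →
    (∀ {l l′} → l ∈ ls → l′ ∈ ls → ∀ x → P l x → P l′ x → l ≡ l′) →
    HasCardinality (λ x → ∃ λ l → l ∈ ls × P l x) (sum (map N ls))
  card-⋃ P N []       _        _    _        = card-∅ (λ { x (l , () , _) })
  card-⋃ P N (l ∷ ls) (l∉ ∷ u) card disjoint = card-⇔
    (λ x → mk⇔
      Sum.[ (λ Plx → l , here refl , Plx) , (λ (l′ , l′∈ , Px) → l′ , there l′∈ , Px) ]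
      λ { (_ , here refl , Px) → inj₁ Px ; (l′ , there l′∈ , Px) → inj₂ (l′ , l′∈ , Px) })
    (card-⊎
      (λ x Plx (l′ , l′∈ , Pl′x) →
        All.lookup l∉ l′∈ (disjoint (here refl) (there l′∈) x Plx Pl′x))
      (card (here refl))
      (card-⋃ P N ls u (card ∘ there) (λ p q → disjoint (there p) (there q))))

-- The number of (u , m) ∈ ℕ × ℕᵏ with 4u + Σ m = M

weight : ∀ {k} → ℕ × Vec ℕ k → ℕ
weight (u , m) = u * 4 + Vec.sum m

#weight : ℕ → ℕ → ℕ
#weight zero    0                            = 1
#weight zero    1                            = 0
#weight zero    2                            = 0
#weight zero    3                            = 0
#weight zero    (suc (suc (suc (suc M))))    = #weight zero M
#weight (suc k) zero                         = #weight k zero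
#weight (suc k) (suc M)                      = #weight (suc k) M + #weight k (suc M)

cons-0 : ∀ {k} → ℕ × Vec ℕ k → ℕ × Vec ℕ (suc k)
cons-0 (u , m) = u , 0 ∷ m

cons-0-injective : ∀ {k} {p q : ℕ × Vec ℕ k} → cons-0 p ≡ cons-0 q → p ≡ q
cons-0-injective eq = cong₂ _,_ (cong proj₁ eq) (Vec.∷-injectiveʳ (cong proj₂ eq))

card-weight : ∀ k M → HasCardinality {ℕ × Vec ℕ k} (λ p → weight p ≡ M) (#weight k M)
card-weight zero 0 = card-⇔
  (λ p → mk⇔ (λ { refl → refl }) (only p)) (card-singleton {ℕ × Vec ℕ 0} (0 , []))
  where
  only : (p : ℕ × Vec ℕ 0) → weight p ≡ 0 → p ≡ (0 , [])
  only (zero , []) _ = refl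
card-weight zero 1 = card-∅ λ { (zero , []) () ; (suc _ , []) () }
card-weight zero 2 = card-∅ λ { (zero , []) () ; (suc _ , []) () }
card-weight zero 3 = card-∅ λ { (zero , []) () ; (suc _ , []) () }
card-weight zero (suc (suc (suc (suc M)))) = card-⇔
  (λ p → mk⇔ (λ { (_ , eq , refl) → cong (λ n → suc (suc (suc (suc n)))) eq }) (lower p))
  (card-image (λ (u , m) → suc u , m)
    (λ eq → cong₂ _,_ (ℕ.suc-injective (cong proj₁ eq)) (cong proj₂ eq)) (card-weight zero M))
  where
  lower : ∀ p → weight p ≡ 4 + M → ∃ λ q → weight q ≡ M × p ≡ (suc (proj₁ q) , proj₂ q)
  lower (suc u , []) eq = (u , []) , ℕ.+-cancelˡ-≡ 4 _ _ eq , refl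
card-weight (suc k) zero = card-⇔
  (λ p → mk⇔ (λ { (_ , eq , refl) → eq }) (drop p))
  (card-image cons-0 cons-0-injective (card-weight k zero))
  where
  drop : ∀ p → weight p ≡ 0 → ∃ λ q → weight q ≡ 0 × p ≡ (proj₁ q , 0 ∷ proj₂ q)
  drop (zero , zero ∷ m) eq = (zero , m) , eq , refl
card-weight (suc k) (suc M) = card-⇔
  (λ p → mk⇔ (λ { (inj₁ (q , eq , refl)) → trans (weight-inc q) (cong suc eq)
                ; (inj₂ (_ , eq , refl)) → eq }) (split p))
  (card-⊎ (λ { _ ((_ , _ ∷ _) , _ , refl) (_ , _ , ()) })
    (card-image inc inc-injective (card-weight (suc k) M))
    (card-image cons-0 cons-0-injective (card-weight k (suc M))))
  where
  inc : ℕ × Vec ℕ (suc k) → ℕ × Vec ℕ (suc k)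
  inc (u , x ∷ m) = u , suc x ∷ m

  inc-injective : ∀ {p q} → inc p ≡ inc q → p ≡ q
  inc-injective {_ , _ ∷ _} {_ , _ ∷ _} refl = refl

  weight-inc : ∀ q → weight (inc q) ≡ suc (weight q)
  weight-inc (u , x ∷ m) = ℕ.+-suc (u * 4) (x + Vec.sum m)

  split : ∀ p → weight p ≡ suc M →
    (∃ λ q → weight q ≡ M × p ≡ inc q) ⊎
    (∃ λ (q : ℕ × Vec ℕ k) → weight q ≡ suc M × p ≡ (proj₁ q , 0 ∷ proj₂ q))
  split (u , zero  ∷ m) eq = inj₂ ((u , m) , eq , refl)
  split (u , suc x ∷ m) eq =
    inj₁ ((u , x ∷ m) , ℕ.suc-injective (trans (sym (weight-inc (u , x ∷ m))) eq) , refl)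

-- A slack variable turns the bound into an equation with one more unknown.

card-weight-≤ : ∀ k M → HasCardinality {ℕ × Vec ℕ k} (λ p → weight p ≤ M) (#weight (suc k) M)
card-weight-≤ k zero    = card-⇔ (λ p → mk⇔ ℕ.≤-reflexive ℕ.n≤0⇒n≡0) (card-weight k zero)
card-weight-≤ k (suc M) = card-⇔
  (λ p → mk⇔ Sum.[ ℕ.m≤n⇒m≤1+n , ℕ.≤-reflexive ]
    λ p≤ → Sum.map ℕ.≤-pred id (ℕ.m≤n⇒m<n∨m≡n p≤))
  (card-⊎ (λ p p≤M p≡ → ℕ.1+n≰n (subst (_≤ M) p≡ p≤M))
    (card-weight-≤ k M) (card-weight k (suc M)))

-- Multiplication of a generating function by a power of q. The filler is a parameter so that the
-- operation commutes with maps such as the embedding of ℕ into ℤ.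
shift : ∀ {A : Set} → A → ℕ → (ℕ → A) → ℕ → A
shift z zero    f n       = f n
shift z (suc e) f zero    = z
shift z (suc e) f (suc n) = shift z e f n

-- The substitution of q^t for q in a generating function.
dilate : ∀ {A : Set} → A → (t : ℕ) .{{_ : NonZero t}} → (ℕ → A) → ℕ → A
dilate z t f n with n % t ℕ.≟ 0
... | yes _ = f (n div t)
... | no  _ = z

module _ {A : Set} (w : A → ℕ) where

  card-shift : ∀ {N} → (∀ n → HasCardinality (λ a → w a ≡ n) (N n)) →
               ∀ e n → HasCardinality (λ a → e + w a ≡ n) (shift 0 e N n)
  card-shift card zero    n       = card n
  card-shift card (suc e) zero    = card-∅ (λ _ ())
  card-shift card (suc e) (suc n) = card-⇔
    (λ a → mk⇔ (cong suc) ℕ.suc-injective) (card-shift card e n)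

  card-shift-≤ : ∀ {N} → (∀ n → HasCardinality (λ a → w a ≤ n) (N n)) →
                 ∀ e n → HasCardinality (λ a → e + w a ≤ n) (shift 0 e N n)
  card-shift-≤ card zero    n       = card n
  card-shift-≤ card (suc e) zero    = card-∅ (λ _ ())
  card-shift-≤ card (suc e) (suc n) = card-⇔ (λ a → mk⇔ s≤s ℕ.≤-pred) (card-shift-≤ card e n)

  card-dilate : ∀ t .{{_ : NonZero t}} {N : ℕ → ℕ} → (∀ n → HasCardinality (λ a → w a ≡ n) (N n)) →
                ∀ n → HasCardinality (λ a → w a * t ≡ n) (dilate 0 t N n)
  card-dilate t card n with n % t ℕ.≟ 0
  ... | yes n%t≡0 = card-⇔ (λ a → mk⇔
    (λ eq → trans (cong (_* t) eq)
      (sym (trans (DM.m≡m%n+[m/n]*n n t) (cong (λ r → r + n div t * t) n%t≡0))))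
    (λ { refl → sym (DM.m*n/n≡m (w a) t) })) (card (n div t))
  ... | no n%t≢0 = card-∅ λ { a refl → n%t≢0 (DM.m*n%n≡0 (w a) t) }

  -- Unlike an equation, a bound imposes no divisibility on n: a multiple of t is at most n exactly
  -- when its cofactor is at most the floor of n / t.
  card-dilate-≤ : ∀ t .{{_ : NonZero t}} {N : ℕ → ℕ} → (∀ n → HasCardinality (λ a → w a ≤ n) (N n)) →
                  ∀ n → HasCardinality (λ a → w a * t ≤ n) (N (n div t))
  card-dilate-≤ t {N} card n = card-⇔ {k = N (n div t)} (λ a → mk⇔
    (λ w≤ → ℕ.≤-trans (ℕ.*-monoˡ-≤ t w≤) (DM.m/n*n≤m n t))
    (λ wt≤ → subst (_≤ n div t) (DM.m*n/n≡m (w a) t) (DM./-monoˡ-≤ t wt≤))) (card (n div t))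

-- Counting the points of a branch

-- The free parameters mᵢ, arranged as a vector. Counting requires propositional equality of
-- parameters, which pointwise equal vectors satisfy and pointwise equal functions need not.
record Insertion {t} (k : ℕ) (rA rB : Fin t) : Set where
  field
    build            : ℕ → ℕ → Vec ℕ k → Fin t → ℕ
    build-A          : ∀ v w m → build v w m rA ≡ v
    build-B          : ∀ v w m → build v w m rB ≡ w
    build-sum        : ∀ v w m → sum (tabulate (build v w m)) ≡ v + (w + Vec.sum m)
    build-injective  : ∀ {v w m v′ w′ m′} → (∀ i → build v w m i ≡ build v′ w′ m′ i) → m ≡ m′
    build-surjective : ∀ (x : Fin t → ℕ) → ∃ λ m → ∀ i → build (x rA) (x rB) m i ≡ x i

sum-insertAt : ∀ {n} (m : Vec ℕ n) i v →
  sum (tabulate (lookup (insertAt m i v))) ≡ v + sum (tabulate (lookup m))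
sum-insertAt m       Fin.zero    v = refl
sum-insertAt (x ∷ m) (Fin.suc i) v = trans (cong (λ s → x + s) (sum-insertAt m i v))
  (swap x v (sum (tabulate (lookup m))))
  where
  swap : ∀ a b c → a + (b + c) ≡ b + (a + c)
  swap = ℕ-Ring.solve-∀

sum-lookup : ∀ {n} (m : Vec ℕ n) → sum (tabulate (lookup m)) ≡ Vec.sum m
sum-lookup []      = refl
sum-lookup (x ∷ m) = cong (λ s → x + s) (sum-lookup m)

lookup-injective : ∀ {n} (m m′ : Vec ℕ n) → (∀ i → lookup m i ≡ lookup m′ i) → m ≡ m′
lookup-injective m m′ eq =
  trans (sym (Vec.tabulate∘lookup m)) (trans (Vec.tabulate-cong eq) (Vec.tabulate∘lookup m′))

insertAt-injective : ∀ {n} (m m′ : Vec ℕ n) i {v v′} → insertAt m i v ≡ insertAt m′ i v′ → m ≡ m′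
insertAt-injective m m′ i {v} {v′} eq = trans (sym (Vec.removeAt-insertAt m i v))
  (trans (cong (λ xs → removeAt xs i) eq) (Vec.removeAt-insertAt m′ i v′))

insertion : ∀ {t} → 2 ≤ t → {rA rB : Fin t} → rA ≢ rB → Insertion (t ∸ 2) rA rB
insertion (s≤s (s≤s _)) {rA} {rB} rA≢rB = record
  { build            = λ v w m → lookup (ins v w m)
  ; build-A          = λ v w m → Vec.insertAt-lookup (insertAt m j w) rA v
  ; build-B          = λ v w m → trans (lookup-B v (insertAt m j w)) (Vec.insertAt-lookup m j w)
  ; build-sum        = λ v w m → trans (sum-insertAt (insertAt m j w) rA v)
      (cong (λ s → v + s) (trans (sum-insertAt m j w) (cong (λ s → w + s) (sum-lookup m))))
  ; build-injective  = λ {v} {w} {m} {v′} {w′} {m′} eq → insertAt-injective m m′ j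
      (insertAt-injective (insertAt m j w) (insertAt m′ j w′) rA
        (lookup-injective (ins v w m) (ins v′ w′ m′) eq))
  ; build-surjective = λ x → removeAt (rest x) j , λ i → trans
      (cong (λ xs → lookup xs i) (restore x)) (Vec.lookup∘tabulate x i)
  }
  where
  -- The position of `rB` after `rA` has been removed; hence `w` is inserted first, at `j`, and `v`
  -- second, at `rA`.
  j = punchOut rA≢rB
  ins : ℕ → ℕ → Vec ℕ _ → Vec ℕ _
  ins v w m = insertAt (insertAt m j w) rA v

  lookup-B : ∀ v m → lookup (insertAt m rA v) rB ≡ lookup m j
  lookup-B v m = trans (cong (lookup (insertAt m rA v)) (sym (Fin.punchIn-punchOut rA≢rB)))
    (Vec.insertAt-punchIn m rA v j)

  rest : (Fin _ → ℕ) → Vec ℕ _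
  rest x = removeAt (Vec.tabulate x) rA

  restore : ∀ x → ins (x rA) (x rB) (removeAt (rest x) j) ≡ Vec.tabulate x
  restore x = begin
    insertAt (insertAt (removeAt (rest x) j) j (x rB)) rA (x rA)
      ≡⟨ cong₂ (λ w v → insertAt (insertAt (removeAt (rest x) j) j w) rA v)
           (trans (Vec.removeAt-punchOut (Vec.tabulate x) rA≢rB) (Vec.lookup∘tabulate x rB))
           (Vec.lookup∘tabulate x rA) ⟨
    insertAt (insertAt (removeAt (rest x) j) j (lookup (rest x) j)) rA (lookup (Vec.tabulate x) rA)
      ≡⟨ cong (λ xs → insertAt xs rA (lookup (Vec.tabulate x) rA)) (Vec.insertAt-removeAt (rest x) j) ⟩
    insertAt (rest x) rA (lookup (Vec.tabulate x) rA)
      ≡⟨ Vec.insertAt-removeAt (Vec.tabulate x) rA ⟩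
    Vec.tabulate x ∎
    where open ≡-Reasoning

-- The least pair of naturals with a given difference

base : ℤ → ℕ × ℕ
base (+ n)      = n , 0
base ℤ.-[1+ n ] = 0 , suc n

base-max : ∀ z → 0ℤ ℤ.⊔ z ≡ + proj₁ (base z)
base-max (+ n)      = refl
base-max ℤ.-[1+ n ] = refl

base-difference : ∀ z u → z ≡ + (proj₁ (base z) + u) ℤ.- + (proj₂ (base z) + u)
base-difference z u = trans (difference z) (cancel (+ proj₁ (base z)) (+ proj₂ (base z)) (+ u))
  where
  difference : ∀ z → z ≡ + proj₁ (base z) ℤ.- + proj₂ (base z)
  difference (+ n)      = sym (ℤ.+-identityʳ (+ n))
  difference ℤ.-[1+ n ] = refl
  cancel : ∀ a b c → a ℤ.- b ≡ (a ℤ.+ c) ℤ.- (b ℤ.+ c)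
  cancel = ℤ-Ring.solve-∀

-- One component of the least pair is 0, so the corresponding component of the given pair is itself
-- the common increment u.
base-least : ∀ z {a b} → z ≡ + a ℤ.- + b →
             ∃ λ u → a ≡ proj₁ (base z) + u × b ≡ proj₂ (base z) + u
base-least (+ n) {a} {b} eq = b ,
  ℤ.+-injective (trans (move (+ a) (+ b)) (cong (ℤ._+ + b) (sym eq))) , refl
  where
  move : ∀ a b → a ≡ a ℤ.- b ℤ.+ b
  move = ℤ-Ring.solve-∀
base-least ℤ.-[1+ n ] {a} {b} eq = a , refl ,
  ℤ.+-injective (trans (move (+ a) (+ b)) (cong (λ z → ℤ.- z ℤ.+ + a) (sym eq)))
  where
  move : ∀ a b → b ≡ ℤ.- (a ℤ.- b) ℤ.+ a
  move = ℤ-Ring.solve-∀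

module _ (t : ℕ) .{{_ : NonZero t}} (2≤t : 2 ≤ t) (d₃ kA kB : ℕ) where

  private
    c′ : Label t → ℤ
    c′ = c t d₃ kA kB

    Fib : Vec ℕ (t + 2) → Set
    Fib = Fibre t (suc kA * t) (suc kB * t) d₃

    Br : Label t → Vec ℕ (t + 2) → Set
    Br = Branch t d₃ kA kB

    IsBr : Label t → Set
    IsBr = IsBranch t d₃ kA kB

    Params : Set
    Params = ℕ × Vec ℕ (t ∸ 2)

  -- The size at u = 0 and m = 0. The components of `base z` are max(0, z) and max(0, -z); each is
  -- doubled because its class has two elements.
  minSize : (rA rB : Fin t) → ℤ → ℕ
  minSize rA rB z = κ t rA rB + (kA + kB + (proj₁ (base z) + proj₂ (base z)) * 2) * t

  -- If (v , w) is the least pair with difference c, then c = v - w and max(0, c) = v, so -2c + 4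
  -- max(0, c) = 2 (v + w). In particular the exponent is a natural number.
  exponent-minSize : ∀ rA rB η → exponent t d₃ kA kB (rA , rB , η) ≡ + minSize rA rB (c′ (rA , rB , η))
  exponent-minSize rA rB η = lemma (c′ (rA , rB , η))
    where
    open ≡-Reasoning
    regroup : ∀ K k l t v w →
      K ℤ.+ t ℤ.* (k ℤ.+ l ℤ.- + 2 ℤ.* (v ℤ.- w)) ℤ.+ + 4 ℤ.* t ℤ.* v ≡
      K ℤ.+ (k ℤ.+ l ℤ.+ (v ℤ.+ w) ℤ.* + 2) ℤ.* t
    regroup = ℤ-Ring.solve-∀

    lemma : ∀ z → + κ t rA rB ℤ.+ + t ℤ.* (+ kA ℤ.+ + kB ℤ.- + 2 ℤ.* z) ℤ.+ + 4 ℤ.* + t ℤ.* (0ℤ ℤ.⊔ z)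
                  ≡ + minSize rA rB z
    lemma z = begin
      + κ t rA rB ℤ.+ + t ℤ.* (+ kA ℤ.+ + kB ℤ.- + 2 ℤ.* z) ℤ.+ + 4 ℤ.* + t ℤ.* (0ℤ ℤ.⊔ z)
        ≡⟨ cong₂ (λ z m → + κ t rA rB ℤ.+ + t ℤ.* (+ kA ℤ.+ + kB ℤ.- + 2 ℤ.* z) ℤ.+ + 4 ℤ.* + t ℤ.* m)
             (trans (base-difference z 0) (cong₂ (λ a b → + a ℤ.- + b) (ℕ.+-identityʳ v) (ℕ.+-identityʳ w)))
             (base-max z) ⟩
      + κ t rA rB ℤ.+ + t ℤ.* (+ kA ℤ.+ + kB ℤ.- + 2 ℤ.* (+ v ℤ.- + w)) ℤ.+ + 4 ℤ.* + t ℤ.* + v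
        ≡⟨ regroup (+ κ t rA rB) (+ kA) (+ kB) (+ t) (+ v) (+ w) ⟩
      + κ t rA rB ℤ.+ (+ kA ℤ.+ + kB ℤ.+ (+ v ℤ.+ + w) ℤ.* + 2) ℤ.* + t
        ≡⟨ cong (λ x → + κ t rA rB ℤ.+ (+ kA ℤ.+ + kB ℤ.+ x) ℤ.* + t) (ℤ.pos-* (v + w) 2) ⟨
      + κ t rA rB ℤ.+ + (kA + kB + (v + w) * 2) ℤ.* + t
        ≡⟨ cong (λ x → + κ t rA rB ℤ.+ x) (ℤ.pos-* (kA + kB + (v + w) * 2) t) ⟨
      + minSize rA rB z ∎
      where
      v = proj₁ (base z)
      w = proj₂ (base z)

  module _ {rA rB : Fin t} (A<B : rA Fin.< rB) (z : ℤ) where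

    private
      A≢B : rA ≢ rB
      A≢B eq = ℕ.<-irrefl (cong toℕ eq) A<B

      open Insertion (insertion 2≤t A≢B)

      levels : Params → Fin t → ℕ
      levels (u , m) = build (proj₁ (base z) + u) (proj₂ (base z) + u) m

    point : Params → Vec ℕ (t + 2)
    point p = proj₁ (coded-exists t A<B kA kB (levels p))

    point-coded : ∀ p → Coded t rA rB kA kB (levels p) (point p)
    point-coded p = proj₁ (proj₂ (coded-exists t A<B kA kB (levels p)))

    point-injective : ∀ {p q} → point p ≡ point q → p ≡ q
    point-injective {u , m} {u′ , m′} eq = cong₂ _,_
      (ℕ.+-cancelˡ-≡ (proj₁ (base z)) u u′
        (trans (sym (build-A _ _ m)) (trans (same rA) (build-A _ _ m′))))
      (build-injective same)
      where
      same : ∀ i → levels (u , m) i ≡ levels (u′ , m′) i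
      same = coded-x-unique t (point-coded (u , m))
        (subst (Coded t rA rB kA kB (levels (u′ , m′))) (sym eq) (point-coded (u′ , m′)))

    -- Increasing u by one raises four elements of the beta set by t, two in each distinguished
    -- class; increasing one mᵢ raises a single element.
    point-size : ∀ p → ∣ point p ∣ₚ ≡ minSize rA rB z + weight p * t
    point-size (u , m) = begin
      ∣ point (u , m) ∣ₚ
        ≡⟨ coded-size t (point-coded (u , m)) ⟩
      κ t rA rB + (levels (u , m) rA + kA + (levels (u , m) rB + kB) + sum (tabulate (levels (u , m)))) * t
        ≡⟨ cong (λ s → κ t rA rB + s * t) (cong₂ _+_
             (cong₂ (λ a b → a + kA + (b + kB)) (build-A _ _ m) (build-B _ _ m)) (build-sum _ _ m)) ⟩
      κ t rA rB + (v + u + kA + (w + u + kB) + (v + u + (w + u + Vec.sum m))) * t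
        ≡⟨ regroup (κ t rA rB) kA kB v w u (Vec.sum m) t ⟩
      minSize rA rB z + weight (u , m) * t ∎
      where
      open ≡-Reasoning
      v = proj₁ (base z)
      w = proj₂ (base z)
      regroup : ∀ K k l v w u s t →
        K + (v + u + k + (w + u + l) + (v + u + (w + u + s))) * t ≡
        K + (k + l + (v + w) * 2) * t + (u * 4 + s) * t
      regroup = ℕ-Ring.solve-∀

    point-difference : ∀ p → z ≡ + levels p rA ℤ.- + levels p rB
    point-difference (u , m) = trans (base-difference z u)
      (cong₂ (λ a b → + a ℤ.- + b) (sym (build-A _ _ m)) (sym (build-B _ _ m)))

    coded⇒point : ∀ {x ν} → Coded t rA rB kA kB x ν → z ≡ + x rA ℤ.- + x rB → ∃ λ p → ν ≡ point p
    coded⇒point {x} C z≡ with u , a≡ , b≡ ← base-least z z≡ | m , x≗ ← build-surjective x =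
      (u , m) , coded-unique t C (coded-cong t
        (λ i → trans (cong₂ (λ v w → build v w m i) (sym a≡) (sym b≡)) (x≗ i))
        (point-coded (u , m)))

  -- The condition `R` on the size is left open so that one argument serves both the sizes equal to
  -- n and the sizes at most n.
  card-branch : ∀ (R : ℕ → Set) {K} ℓ → IsBr ℓ → let (rA , rB , _) = ℓ in
    HasCardinality {Params} (λ p → R (minSize rA rB (c′ ℓ) + weight p * t)) K →
    HasCardinality (λ ν → Br ℓ ν × R ∣ ν ∣ₚ) K
  card-branch R ℓ@(rA , rB , η) (A<B , _) card = card-⇔
    (λ ν → mk⇔
      (λ (p , Rp , ν≡) → subst (λ μ → Br ℓ μ × R ∣ μ ∣ₚ) (sym ν≡)
        (⇔-from (branch⇔coded t d₃ kA kB {rA} {rB} {η})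
          (_ , point-coded A<B z p , point-difference A<B z p) ,
        subst R (sym (point-size A<B z p)) Rp))
      (λ (br , Rν) →
        let x , C , c≡ = ⇔-to (branch⇔coded t d₃ kA kB {rA} {rB} {η}) br
            p , ν≡     = coded⇒point A<B z C c≡
        in p , subst R (trans (cong ∣_∣ₚ ν≡) (point-size A<B z p)) Rν , ν≡))
    (card-image (point A<B z) (point-injective A<B z) card)
    where z = c′ ℓ

  -- The fibre as a union over the list of branches

  private
    bs : List (Label t)
    bs = branches t d₃ kA kB

    candidates : List (Label t)
    candidates = cartesianProduct (allFin t) (cartesianProduct (allFin t) (signs d₃))

  ∈-signs : ∀ d η → η ∈ signs d ⊎ (d ≡ 0 × η ≡ Sign.-)
  ∈-signs zero    Sign.+ = inj₁ (here refl)
  ∈-signs zero    Sign.- = inj₂ (refl , refl)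
  ∈-signs (suc d) Sign.+ = inj₁ (here refl)
  ∈-signs (suc d) Sign.- = inj₁ (there (here refl))

  signs-unique : ∀ d → Unique (signs d)
  signs-unique zero    = [] ∷ []
  signs-unique (suc d) = ((λ ()) ∷ []) ∷ [] ∷ []

  signs-zero : ∀ {η η′ d} → η ∈ signs d → η′ ∈ signs d → d ≡ 0 → η ≡ η′
  signs-zero (here refl) (here refl) refl = refl

  branches-unique : Unique bs
  branches-unique = Unique.filter⁺ (isBranch? t d₃ kA kB) (Unique.cartesianProduct⁺ (Unique.allFin⁺ t)
    (Unique.cartesianProduct⁺ (Unique.allFin⁺ t) (signs-unique d₃)))

  ∈-branches⁺ : ∀ {rA rB η} → η ∈ signs d₃ → IsBr (rA , rB , η) → (rA , rB , η) ∈ bs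
  ∈-branches⁺ {rA} {rB} η∈ = ∈.∈-filter⁺ (isBranch? t d₃ kA kB)
    (∈.∈-cartesianProduct⁺ (∈.∈-allFin rA) (∈.∈-cartesianProduct⁺ (∈.∈-allFin rB) η∈))

  ∈-branches⁻ : ∀ {rA rB η} → (rA , rB , η) ∈ bs → η ∈ signs d₃ × IsBr (rA , rB , η)
  ∈-branches⁻ ℓ∈ = let ℓ∈′ , isBranch = ∈.∈-filter⁻ (isBranch? t d₃ kA kB) {xs = candidates} ℓ∈ in
    proj₂ (∈.∈-cartesianProduct⁻ (allFin t) (signs d₃)
      (proj₂ (∈.∈-cartesianProduct⁻ (allFin t) (cartesianProduct (allFin t) (signs d₃)) ℓ∈′))) ,
    isBranch

  fibre⇒listed : ∀ {ν} → Fib ν → ∃ λ ℓ → ℓ ∈ bs × Br ℓ ν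
  fibre⇒listed {ν} fib = let (rA , rB , η) , isBranch , br = fibre⇒branch t d₃ kA kB fib in
    list rA rB η (∈-signs d₃ η) isBranch br
    where
    list : ∀ rA rB η → η ∈ signs d₃ ⊎ (d₃ ≡ 0 × η ≡ Sign.-) → IsBr (rA , rB , η) →
           Br (rA , rB , η) ν → ∃ λ ℓ → ℓ ∈ bs × Br ℓ ν
    list rA rB η (inj₁ η∈) isBranch br = (rA , rB , η) , ∈-branches⁺ η∈ isBranch , br
    -- The label with sign - is not listed when d₃ = 0; its branch is the one listed under +.
    list rA rB _ (inj₂ (d₃≡0 , refl)) isBranch br =
      let isBr⇔ , br⇔ = signs-agree t d₃ kA kB d₃≡0 rA rB in
      (rA , rB , Sign.+) ,
      ∈-branches⁺ (subst (λ d → Sign.+ ∈ signs d) (sym d₃≡0) (here refl)) (⇔-from isBr⇔ isBranch) ,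
      ⇔-from (br⇔ ν) br

  listed-unique : ∀ {ℓ ℓ′ ν} → ℓ ∈ bs → ℓ′ ∈ bs → Br ℓ ν → Br ℓ′ ν → ℓ ≡ ℓ′
  listed-unique {ℓ} {ℓ′} {ν} ℓ∈ ℓ′∈ br br′ =
    let η∈  , isBr  = ∈-branches⁻ ℓ∈
        η′∈ , isBr′ = ∈-branches⁻ ℓ′∈
        rA≡ , rB≡ , η≡ = branches-disjoint t d₃ kA kB ℓ ℓ′ isBr isBr′ ν br br′
    in cong₂ _,_ rA≡ (cong₂ _,_ rB≡ (Sum.[ id , signs-zero η∈ η′∈ ] η≡))

  card-fibre : ∀ (R : ℕ → Set) (N : Label t → ℕ) →
    (∀ ℓ → IsBr ℓ → HasCardinality (λ ν → Br ℓ ν × R ∣ ν ∣ₚ) (N ℓ)) →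
    HasCardinality (λ ν → Fib ν × R ∣ ν ∣ₚ) (sum (map N bs))
  card-fibre R N card = card-⇔
    (λ ν → mk⇔
      (λ ((rA , rB , η) , ℓ∈ , br , Rν) →
        branch⇒fibre t d₃ kA kB {rA} {rB} {η} (proj₂ (∈-branches⁻ ℓ∈)) br , Rν)
      (λ (fib , Rν) → let ℓ , ℓ∈ , br = fibre⇒listed fib in ℓ , ℓ∈ , br , Rν))
    (card-⋃ (λ ℓ ν → Br ℓ ν × R ∣ ν ∣ₚ) N bs branches-unique
      (λ {ℓ} ℓ∈ → card ℓ (proj₂ (∈-branches⁻ ℓ∈)))
      (λ ℓ∈ ℓ′∈ ν (br , _) (br′ , _) → listed-unique ℓ∈ ℓ′∈ br br′))

  #size : ℕ → ℕ
  #size n = sum (map (λ ℓ@(rA , rB , _) →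
    shift 0 (minSize rA rB (c′ ℓ)) (dilate 0 t (#weight (t ∸ 2))) n) bs)

  card-size : ∀ n → HasCardinality (λ ν → Fib ν × ∣ ν ∣ₚ ≡ n) (#size n)
  card-size n = card-fibre (_≡ n) _ λ ℓ@(rA , rB , _) isBranch → card-branch (_≡ n) ℓ isBranch
    (card-shift (λ p → weight p * t) (card-dilate weight t (card-weight (t ∸ 2)))
      (minSize rA rB (c′ ℓ)) n)

  #size≤ : ℕ → ℕ
  #size≤ n = sum (map (λ ℓ@(rA , rB , _) →
    shift 0 (minSize rA rB (c′ ℓ)) (λ n → #weight (suc (t ∸ 2)) (n div t)) n) bs)

  card-size≤ : ∀ n → HasCardinality (λ ν → Fib ν × ∣ ν ∣ₚ ≤ n) (#size≤ n)
  card-size≤ n = card-fibre (_≤ n) _ λ ℓ@(rA , rB , _) isBranch → card-branch (_≤ n) ℓ isBranch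
    (card-shift-≤ (λ p → weight p * t) (card-dilate-≤ weight t (card-weight-≤ (t ∸ 2)))
      (minSize rA rB (c′ ℓ)) n)

-- Power series

-- The Cauchy product by recursion along the left factor, which replaces the truncated index `n ∸ k`
-- by something suited to induction.
convolve : Series → Series → Series
convolve f g zero    = f 0 ℤ.* g 0
convolve f g (suc n) = f 0 ℤ.* g (suc n) ℤ.+ convolve (f ∘ suc) g n

⊛-convolve : ∀ f g n → (f ⊛ g) n ≡ convolve f g n
⊛-convolve f g n = trans
  (cong sumℤ (List.map-upTo (λ i → f i ℤ.* g (n ∸ i)) (suc n))) (go f n)
  where
  go : ∀ f n → sumℤ (applyUpTo (λ i → f i ℤ.* g (n ∸ i)) (suc n)) ≡ convolve f g n
  go f zero    = ℤ.+-identityʳ _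
  go f (suc n) = cong (ℤ._+_ (f 0 ℤ.* g (suc n))) (go (f ∘ suc) n)

convolve-cong : ∀ {f f′ g g′} → (∀ n → f n ≡ f′ n) → (∀ n → g n ≡ g′ n) →
                ∀ n → convolve f g n ≡ convolve f′ g′ n
convolve-cong f≗ g≗ zero    = cong₂ ℤ._*_ (f≗ 0) (g≗ 0)
convolve-cong f≗ g≗ (suc n) =
  cong₂ ℤ._+_ (cong₂ ℤ._*_ (f≗ 0) (g≗ (suc n))) (convolve-cong (f≗ ∘ suc) g≗ n)

convolve-⊖ˡ : ∀ f f′ g n → convolve (f ⊖ f′) g n ≡ convolve f g n ℤ.- convolve f′ g n
convolve-⊖ˡ f f′ g zero    = lemma (f 0) (f′ 0) (g 0)
  where
  lemma : ∀ a b c → (a ℤ.- b) ℤ.* c ≡ a ℤ.* c ℤ.- b ℤ.* c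
  lemma = ℤ-Ring.solve-∀
convolve-⊖ˡ f f′ g (suc n) =
  trans (cong (ℤ._+_ ((f 0 ℤ.- f′ 0) ℤ.* g (suc n))) (convolve-⊖ˡ (f ∘ suc) (f′ ∘ suc) g n))
    (lemma (f 0) (f′ 0) (g (suc n)) (convolve (f ∘ suc) g n) (convolve (f′ ∘ suc) g n))
  where
  lemma : ∀ a b c x y → (a ℤ.- b) ℤ.* c ℤ.+ (x ℤ.- y) ≡ (a ℤ.* c ℤ.+ x) ℤ.- (b ℤ.* c ℤ.+ y)
  lemma = ℤ-Ring.solve-∀

convolve-⊖ʳ : ∀ f g g′ n → convolve f (g ⊖ g′) n ≡ convolve f g n ℤ.- convolve f g′ n
convolve-⊖ʳ f g g′ zero    = lemma (f 0) (g 0) (g′ 0)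
  where
  lemma : ∀ a b c → a ℤ.* (b ℤ.- c) ≡ a ℤ.* b ℤ.- a ℤ.* c
  lemma = ℤ-Ring.solve-∀
convolve-⊖ʳ f g g′ (suc n) =
  trans (cong (ℤ._+_ (f 0 ℤ.* (g (suc n) ℤ.- g′ (suc n)))) (convolve-⊖ʳ (f ∘ suc) g g′ n))
    (lemma (f 0) (g (suc n)) (g′ (suc n)) (convolve (f ∘ suc) g n) (convolve (f ∘ suc) g′ n))
  where
  lemma : ∀ a b c x y → a ℤ.* (b ℤ.- c) ℤ.+ (x ℤ.- y) ≡ (a ℤ.* b ℤ.+ x) ℤ.- (a ℤ.* c ℤ.+ y)
  lemma = ℤ-Ring.solve-∀

convolve-zeroˡ : ∀ {f} g → (∀ n → f n ≡ 0ℤ) → ∀ n → convolve f g n ≡ 0ℤ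
convolve-zeroˡ g f≡0 zero    = cong (ℤ._* g 0) (f≡0 0)
convolve-zeroˡ g f≡0 (suc n) =
  cong₂ ℤ._+_ (cong (ℤ._* g (suc n)) (f≡0 0)) (convolve-zeroˡ g (f≡0 ∘ suc) n)

convolve-1ʳ : ∀ f n → convolve f 1ˢ n ≡ f n
convolve-1ʳ f zero    = ℤ.*-identityʳ (f 0)
convolve-1ʳ f (suc n) = trans (cong₂ ℤ._+_ (ℤ.*-zeroʳ (f 0)) (convolve-1ʳ (f ∘ suc) n))
  (ℤ.+-identityˡ (f (suc n)))

q^-suc : ∀ k n → (q^ (+ suc k)) (suc n) ≡ (q^ (+ k)) n
q^-suc k n with + suc n ℤ.≟ + suc k | + n ℤ.≟ + k
... | yes _  | yes _  = refl
... | no  _  | no  _  = refl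
... | yes eq | no  ≢  = contradiction (cong (λ z → z ℤ.- 1ℤ) eq) ≢
... | no  ≢  | yes eq = contradiction (cong ℤ.suc eq) ≢

-- Difference operators on power series

shiftˢ : ℕ → Series → Series
shiftˢ = shift 0ℤ

Δ : ℕ → Series → Series
Δ k f = f ⊖ shiftˢ k f

shift-cong : ∀ k {f g : Series} → (∀ n → f n ≡ g n) → ∀ n → shiftˢ k f n ≡ shiftˢ k g n
shift-cong zero    f≗g n       = f≗g n
shift-cong (suc k) f≗g zero    = refl
shift-cong (suc k) f≗g (suc n) = shift-cong k f≗g n

Δ-cong : ∀ k {f g} → (∀ n → f n ≡ g n) → ∀ n → Δ k f n ≡ Δ k g n
Δ-cong k f≗g n = cong₂ ℤ._-_ (f≗g n) (shift-cong k f≗g n)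

convolve-q^ : ∀ k g n → convolve (q^ (+ k)) g n ≡ shiftˢ k g n
convolve-q^ zero    g zero    = ℤ.*-identityˡ (g 0)
convolve-q^ zero    g (suc n) =
  trans (cong₂ ℤ._+_ (ℤ.*-identityˡ (g (suc n))) (convolve-zeroˡ g (λ _ → refl) n))
    (ℤ.+-identityʳ (g (suc n)))
convolve-q^ (suc k) g zero    = refl
convolve-q^ (suc k) g (suc n) = trans (ℤ.+-identityˡ _)
  (trans (convolve-cong (q^-suc k) (λ _ → refl) n) (convolve-q^ k g n))

convolve-shiftʳ : ∀ f k g n → convolve f (shiftˢ k g) n ≡ shiftˢ k (convolve f g) n
convolve-shiftʳ f zero    g n       = refl
convolve-shiftʳ f (suc k) g zero    = ℤ.*-zeroʳ (f 0)
convolve-shiftʳ f (suc k) g (suc n) = trans (drop f n) (convolve-shiftʳ f k g n)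
  where
  drop : ∀ f n → convolve f (shiftˢ (suc k) g) (suc n) ≡ convolve f (shiftˢ k g) n
  drop f zero    = trans (cong (ℤ._+_ (f 0 ℤ.* shiftˢ k g 0)) (ℤ.*-zeroʳ (f 1))) (ℤ.+-identityʳ _)
  drop f (suc n) = cong (ℤ._+_ (f 0 ℤ.* shiftˢ k g (suc n))) (drop (f ∘ suc) n)

-- Each factor of the denominator is pulled out as an operator on the remaining product, so that
-- associativity and commutativity of `_⊛_` are never invoked.
⊛-Δ : ∀ f k g n → (f ⊛ ((1ˢ ⊖ q^ (+ k)) ⊛ g)) n ≡ Δ k (f ⊛ g) n
⊛-Δ f k g n = begin
  (f ⊛ ((1ˢ ⊖ q^ (+ k)) ⊛ g)) n
    ≡⟨ ⊛-convolve f _ n ⟩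
  convolve f ((1ˢ ⊖ q^ (+ k)) ⊛ g) n
    ≡⟨ convolve-cong (λ _ → refl) (λ n → trans (⊛-convolve (1ˢ ⊖ q^ (+ k)) g n)
         (trans (convolve-⊖ˡ 1ˢ (q^ (+ k)) g n)
           (cong₂ ℤ._-_ (convolve-q^ 0 g n) (convolve-q^ k g n)))) n ⟩
  convolve f (Δ k g) n
    ≡⟨ convolve-⊖ʳ f g (shiftˢ k g) n ⟩
  convolve f g n ℤ.- convolve f (shiftˢ k g) n
    ≡⟨ cong (λ z → convolve f g n ℤ.- z) (convolve-shiftʳ f k g n) ⟩
  Δ k (convolve f g) n
    ≡⟨ Δ-cong k (⊛-convolve f g) n ⟨
  Δ k (f ⊛ g) n ∎
  where open ≡-Reasoning

Δ^ : ℕ → ℕ → Series → Series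
Δ^ zero    k f = f
Δ^ (suc j) k f = Δ k (Δ^ j k f)

⊛-Δ^ : ∀ f k j n → (f ⊛ (1ˢ ⊖ q^ (+ k)) ^ˢ j) n ≡ Δ^ j k f n
⊛-Δ^ f k zero    n = trans (⊛-convolve f 1ˢ n) (convolve-1ʳ f n)
⊛-Δ^ f k (suc j) n = trans (⊛-Δ f k ((1ˢ ⊖ q^ (+ k)) ^ˢ j) n) (Δ-cong k (⊛-Δ^ f k j) n)

Δ^-cong : ∀ j k {f g} → (∀ n → f n ≡ g n) → ∀ n → Δ^ j k f n ≡ Δ^ j k g n
Δ^-cong zero    k f≗g = f≗g
Δ^-cong (suc j) k f≗g = Δ-cong k (Δ^-cong j k f≗g)

-- The recursion of `#weight` consumes the innermost difference, whereas `Δ^` unfolds at the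
-- outermost.
Δ^-suc : ∀ j k f n → Δ^ (suc j) k f n ≡ Δ^ j k (Δ k f) n
Δ^-suc zero    k f n = refl
Δ^-suc (suc j) k f n = Δ-cong k (Δ^-suc j k f) n

module _ {A : Set} where

  Σˢ-cong : ∀ {F G : A → Series} (xs : List A) → (∀ x n → F x n ≡ G x n) →
            ∀ n → Σˢ xs F n ≡ Σˢ xs G n
  Σˢ-cong []       F≗G n = refl
  Σˢ-cong (x ∷ xs) F≗G n = cong₂ ℤ._+_ (F≗G x n) (Σˢ-cong xs F≗G n)

  shift-Σˢ : ∀ k (xs : List A) F n → shiftˢ k (Σˢ xs F) n ≡ Σˢ xs (λ x → shiftˢ k (F x)) n
  shift-Σˢ zero    xs       F n       = refl
  shift-Σˢ (suc k) []       F zero    = refl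
  shift-Σˢ (suc k) (x ∷ xs) F zero    = trans (shift-Σˢ (suc k) xs F zero) (sym (ℤ.+-identityˡ _))
  shift-Σˢ (suc k) xs       F (suc n) = shift-Σˢ k xs F n

  Δ-Σˢ : ∀ k (xs : List A) F n → Δ k (Σˢ xs F) n ≡ Σˢ xs (λ x → Δ k (F x)) n
  Δ-Σˢ k xs F n = trans (cong (λ z → Σˢ xs F n ℤ.- z) (shift-Σˢ k xs F n)) (difference xs)
    where
    interchange : ∀ a b c d → (a ℤ.+ b) ℤ.- (c ℤ.+ d) ≡ (a ℤ.- c) ℤ.+ (b ℤ.- d)
    interchange = ℤ-Ring.solve-∀
    difference : ∀ xs → Σˢ xs F n ℤ.- Σˢ xs (λ x → shiftˢ k (F x)) n ≡ Σˢ xs (λ x → Δ k (F x)) n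
    difference []       = refl
    difference (x ∷ xs) = trans (interchange (F x n) (Σˢ xs F n) (shiftˢ k (F x) n) _)
      (cong (ℤ._+_ (Δ k (F x) n)) (difference xs))

  Δ^-Σˢ : ∀ j k (xs : List A) F n → Δ^ j k (Σˢ xs F) n ≡ Σˢ xs (λ x → Δ^ j k (F x)) n
  Δ^-Σˢ zero    k xs F n = refl
  Δ^-Σˢ (suc j) k xs F n = trans (Δ-cong k (Δ^-Σˢ j k xs F) n) (Δ-Σˢ k xs (λ x → Δ^ j k (F x)) n)

  pos-sum : ∀ (xs : List A) (N : A → ℕ) → + sum (map N xs) ≡ sumℤ (map (λ x → + N x) xs)
  pos-sum []       N = refl
  pos-sum (x ∷ xs) N = cong (ℤ._+_ (+ N x)) (pos-sum xs N)

shift-⊖ : ∀ k f g n → shiftˢ k (f ⊖ g) n ≡ shiftˢ k f n ℤ.- shiftˢ k g n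
shift-⊖ zero    f g n       = refl
shift-⊖ (suc k) f g zero    = refl
shift-⊖ (suc k) f g (suc n) = shift-⊖ k f g n

shift-comm : ∀ j k f n → shiftˢ j (shiftˢ k f) n ≡ shiftˢ k (shiftˢ j f) n
shift-comm zero    k f n       = refl
shift-comm (suc j) k f zero    = zero-start k
  where
  zero-start : ∀ k → 0ℤ ≡ shiftˢ k (shiftˢ (suc j) f) 0
  zero-start zero    = refl
  zero-start (suc k) = refl
shift-comm (suc j) k f (suc n) = trans (shift-comm j k f n) (step k n)
  where
  step : ∀ k n → shiftˢ k (shiftˢ j f) n ≡ shiftˢ k (shiftˢ (suc j) f) (suc n)
  step zero          n       = refl
  step (suc zero)    zero    = refl
  step (suc (suc k)) zero    = refl
  step (suc k)       (suc n) = step k n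

Δ-shift : ∀ k e f n → Δ k (shiftˢ e f) n ≡ shiftˢ e (Δ k f) n
Δ-shift k e f n = trans (cong (λ z → shiftˢ e f n ℤ.- z) (shift-comm k e f n))
  (sym (shift-⊖ e f (shiftˢ k f) n))

shift-< : ∀ {A : Set} {z : A} {k n} f → n < k → shift z k f n ≡ z
shift-< {k = suc k} {zero}  f _         = refl
shift-< {k = suc k} {suc n} f (s≤s n<k) = shift-< f n<k

shift-+ : ∀ {A : Set} {z : A} k f n → shift z k f (k + n) ≡ f n
shift-+ zero    f n = refl
shift-+ (suc k) f n = shift-+ k f n

shift-map : ∀ {A B : Set} (h : A → B) {z} k f n → h (shift z k f n) ≡ shift (h z) k (h ∘ f) n
shift-map h zero    f n       = refl
shift-map h (suc k) f zero    = refl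
shift-map h (suc k) f (suc n) = shift-map h k f n

q^-shift : ∀ k n → (q^ (+ k)) n ≡ shiftˢ k 1ˢ n
q^-shift zero    n       = refl
q^-shift (suc k) zero    = refl
q^-shift (suc k) (suc n) = trans (q^-suc k n) (q^-shift k n)

module _ (t : ℕ) .{{_ : NonZero t}} where

  dilateˢ : Series → Series
  dilateˢ = dilate 0ℤ t

  dilate-map : ∀ {A B : Set} (h : A → B) {z} f n → h (dilate z t f n) ≡ dilate (h z) t (h ∘ f) n
  dilate-map h f n with n % t ℕ.≟ 0
  ... | yes _ = refl
  ... | no  _ = refl

  dilate-cong : ∀ {f g : Series} → (∀ n → f n ≡ g n) → ∀ n → dilateˢ f n ≡ dilateˢ g n
  dilate-cong f≗g n with n % t ℕ.≟ 0
  ... | yes _ = f≗g (n div t)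
  ... | no  _ = refl

  dilate-1 : ∀ n → dilateˢ 1ˢ n ≡ 1ˢ n
  dilate-1 n with n % t ℕ.≟ 0
  dilate-1 zero    | yes _  = cong 1ˢ (DM.0/n≡0 t)
  dilate-1 zero    | no ≢0  = contradiction (DM.m*n%n≡0 0 t) ≢0
  dilate-1 (suc n) | no _   = refl
  dilate-1 (suc n) | yes eq with suc n div t in eq′
  ... | suc q = refl
  ... | zero with () ← trans (DM.m≡m%n+[m/n]*n (suc n) t) (cong₂ (λ r q → r + q * t) eq eq′)

  -- Substituting q^t for q turns the factor q^k into q^(kt). Below k t both sides vanish; from
  -- there on remainders agree and quotients differ by k.
  shift-dilate : ∀ k f n → shiftˢ (k * t) (dilateˢ f) n ≡ dilateˢ (shiftˢ k f) n
  shift-dilate k f n with n ℕ.<? k * t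
  ... | yes n<kt = trans (shift-< (dilateˢ f) n<kt) (sym small)
    where
    small : dilateˢ (shiftˢ k f) n ≡ 0ℤ
    small with n % t ℕ.≟ 0
    ... | yes _ = shift-< f (DM.m<n*o⇒m/o<n {n} {k} {t} n<kt)
    ... | no  _ = refl
  ... | no n≮kt = subst (λ n → shiftˢ (k * t) (dilateˢ f) n ≡ dilateˢ (shiftˢ k f) n)
    (ℕ.m+[n∸m]≡n (ℕ.≮⇒≥ n≮kt)) (trans (shift-+ (k * t) (dilateˢ f) m) (sym large))
    where
    m = n ∸ k * t
    rem : (k * t + m) % t ≡ m % t
    rem = DM.%-remove-+ˡ {k * t} m (divides k refl)
    quo : (k * t + m) div t ≡ k + m div t
    quo = trans (DM.+-distrib-/-∣ˡ {k * t} m (divides k refl)) (cong (_+ m div t) (DM.m*n/n≡m k t))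
    large : dilateˢ (shiftˢ k f) (k * t + m) ≡ dilateˢ f m
    large with (k * t + m) % t ℕ.≟ 0 | m % t ℕ.≟ 0
    ... | yes _  | yes _  = trans (cong (shiftˢ k f) quo) (shift-+ k f (m div t))
    ... | no  _  | no  _  = refl
    ... | yes eq | no ≢   = contradiction (trans (sym rem) eq) ≢
    ... | no ≢   | yes eq = contradiction (trans rem eq) ≢

  Δ-dilate : ∀ k f n → Δ (k * t) (dilateˢ f) n ≡ dilateˢ (Δ k f) n
  Δ-dilate k f n = trans (cong (λ z → dilateˢ f n ℤ.- z) (shift-dilate k f n)) difference
    where
    difference : dilateˢ f n ℤ.- dilateˢ (shiftˢ k f) n ≡ dilateˢ (Δ k f) n
    difference with n % t ℕ.≟ 0
    ... | yes _ = refl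
    ... | no  _ = refl

  Δ-shift-dilate : ∀ k {f g : Series} → (∀ n → Δ k f n ≡ g n) →
    ∀ e n → Δ (k * t) (shiftˢ e (dilateˢ f)) n ≡ shiftˢ e (dilateˢ g) n
  Δ-shift-dilate k {f} eq e n = trans (Δ-shift (k * t) e (dilateˢ f) n)
    (shift-cong e (λ n → trans (Δ-dilate k f n) (dilate-cong eq n)) n)

  #weightˢ : ℕ → Series
  #weightˢ j n = + #weight j n

  Δ-#weight-suc : ∀ j n → Δ 1 (#weightˢ (suc j)) n ≡ #weightˢ j n
  Δ-#weight-suc j zero    = ℤ.+-identityʳ _
  Δ-#weight-suc j (suc n) = cancel (#weightˢ (suc j) n) (#weightˢ j (suc n))
    where
    cancel : ∀ a b → a ℤ.+ b ℤ.- a ≡ b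
    cancel = ℤ-Ring.solve-∀

  Δ-#weight-zero : ∀ n → Δ 4 (#weightˢ 0) n ≡ 1ˢ n
  Δ-#weight-zero 0 = refl
  Δ-#weight-zero 1 = refl
  Δ-#weight-zero 2 = refl
  Δ-#weight-zero 3 = refl
  Δ-#weight-zero (suc (suc (suc (suc n)))) = ℤ.+-inverseʳ (#weightˢ 0 n)

  Δ^-#weight : ∀ j e n → Δ^ j t (shiftˢ e (dilateˢ (#weightˢ j))) n ≡ shiftˢ e (dilateˢ (#weightˢ 0)) n
  Δ^-#weight zero    e n = refl
  Δ^-#weight (suc j) e n = trans (Δ^-suc j t _ n) (trans
    (Δ^-cong j t (subst (λ s → ∀ n → Δ s (shiftˢ e (dilateˢ (#weightˢ (suc j)))) n
                                     ≡ shiftˢ e (dilateˢ (#weightˢ j)) n)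
      (ℕ.*-identityˡ t) (Δ-shift-dilate 1 (Δ-#weight-suc j) e)) n)
    (Δ^-#weight j e n))

  -- Each factor 1 - q^t removes one mᵢ and the factor 1 - q^(4t) removes u; the monomial of the
  -- least point of the branch is left.
  Δ-all-#weight : ∀ j e n →
    Δ (4 * t) (Δ^ j t (shiftˢ e (dilateˢ (#weightˢ j)))) n ≡ (q^ (+ e)) n
  Δ-all-#weight j e n = begin
    Δ (4 * t) (Δ^ j t (shiftˢ e (dilateˢ (#weightˢ j)))) n  ≡⟨ Δ-cong (4 * t) (Δ^-#weight j e) n ⟩
    Δ (4 * t) (shiftˢ e (dilateˢ (#weightˢ 0))) n           ≡⟨ Δ-shift-dilate 4 Δ-#weight-zero e n ⟩
    shiftˢ e (dilateˢ 1ˢ) n                                 ≡⟨ shift-cong e dilate-1 n ⟩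
    shiftˢ e 1ˢ n                                           ≡⟨ q^-shift e n ⟨
    (q^ (+ e)) n                                            ∎
    where open ≡-Reasoning

module _ (t : ℕ) .{{_ : NonZero t}} (2≤t : 2 ≤ t) (d₃ kA kB : ℕ) where

  generating-function :
    (λ n → + #size t 2≤t d₃ kA kB n)
      ≗ Σˢ (branches t d₃ kA kB) (λ ℓ → q^ (exponent t d₃ kA kB ℓ))
      ÷ ((1ˢ ⊖ q^ (+ (4 * t))) ⊛ (1ˢ ⊖ q^ (+ t)) ^ˢ (t ∸ 2))
  generating-function n = begin
    (F ⊛ ((1ˢ ⊖ q^ (+ (4 * t))) ⊛ (1ˢ ⊖ q^ (+ t)) ^ˢ j)) n
      ≡⟨ ⊛-Δ F (4 * t) _ n ⟩
    Δ (4 * t) (F ⊛ (1ˢ ⊖ q^ (+ t)) ^ˢ j) n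
      ≡⟨ Δ-cong (4 * t) (λ n → trans (⊛-Δ^ F t j n) (Δ^-cong j t F-sum n)) n ⟩
    Δ (4 * t) (Δ^ j t (Σˢ bs B)) n
      ≡⟨ Δ-cong (4 * t) (Δ^-Σˢ j t bs B) n ⟩
    Δ (4 * t) (Σˢ bs (λ ℓ → Δ^ j t (B ℓ))) n
      ≡⟨ Δ-Σˢ (4 * t) bs (λ ℓ → Δ^ j t (B ℓ)) n ⟩
    Σˢ bs (λ ℓ → Δ (4 * t) (Δ^ j t (B ℓ))) n
      ≡⟨ Σˢ-cong bs (λ ℓ@(rA , rB , η) n → trans (Δ-all-#weight t j (e ℓ) n)
           (cong (λ z → (q^ z) n) (sym (exponent-minSize t 2≤t d₃ kA kB rA rB η)))) n ⟩
    Σˢ bs (λ ℓ → q^ (exponent t d₃ kA kB ℓ)) n ∎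
    where
    open ≡-Reasoning
    j = t ∸ 2
    bs = branches t d₃ kA kB
    F : Series
    F n = + #size t 2≤t d₃ kA kB n

    e : Label t → ℕ
    e ℓ@(rA , rB , _) = minSize t 2≤t d₃ kA kB rA rB (c t d₃ kA kB ℓ)

    B : Label t → Series
    B ℓ = shiftˢ (e ℓ) (dilateˢ t (#weightˢ t j))

    F-sum : ∀ n → F n ≡ Σˢ bs B n
    F-sum n = trans (pos-sum bs (λ ℓ → shift 0 (e ℓ) (dilate 0 t (#weight j)) n))
      (Σˢ-cong bs (λ ℓ n → trans (shift-map pos (e ℓ) (dilate 0 t (#weight j)) n)
        (shift-cong (e ℓ) (dilate-map t pos (#weight j)) n)) n)

-- Quasi-polynomials

module ℚS = ℚ-Solver.+-*-Solver

pow : ℚ → ℕ → ℚ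
pow x zero    = 1ℚ
pow x (suc d) = x ℚ.* pow x d

ιℕ : ℕ → ℚ
ιℕ n = ι (+ n)

ιℕ-+ : ∀ m n → ιℕ (m + n) ≡ ιℕ m ℚ.+ ιℕ n
ιℕ-+ m n = ι-+ (+ m) (+ n)

ιℕ-pow : ∀ n d → ιℕ (n ^ d) ≡ pow (ιℕ n) d
ιℕ-pow n zero    = refl
ιℕ-pow n (suc d) = trans (cong ι (ℤ.pos-* n (n ^ d)))
  (trans (ι-* (+ n) (+ (n ^ d))) (cong (ιℕ n ℚ.*_) (ιℕ-pow n d)))

module QuasiPolynomials (p : ℕ) .{{_ : NonZero p}} where

  Per : (ℕ → ℚ) → Set
  Per f = ∀ n → f (n + p) ≡ f n

  -- QP d consists of the quasi-polynomials of period p and degree less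
  -- than d; Leads d a f says that f has degree at most d and the
  -- (periodic) coefficient a in degree d.

  QP : ℕ → (ℕ → ℚ) → Set
  Leads : ℕ → (ℕ → ℚ) → (ℕ → ℚ) → Set

  QP zero    f = ∀ n → f n ≡ 0ℚ
  QP (suc d) f = ∃ λ a → Per a × Leads d a f

  Leads d a f = ∃ λ g → QP d g × (∀ n → f n ≡ g n ℚ.+ a n ℚ.* pow (ιℕ n) d)

  qp-cong : ∀ d {f g} → (∀ n → f n ≡ g n) → QP d f → QP d g
  qp-cong zero    f≗g f≡0                  n = trans (sym (f≗g n)) (f≡0 n)
  qp-cong (suc d) f≗g (a , per , h , qh , eq) =
    a , per , h , qh , λ n → trans (sym (f≗g n)) (eq n)

  leads-+ : ∀ d {a b f g} → Leads d a f → Leads d b g →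
            Leads d (λ n → a n ℚ.+ b n) (λ n → f n ℚ.+ g n)
  qp-+ : ∀ d {f g} → QP d f → QP d g → QP d (λ n → f n ℚ.+ g n)

  leads-+ d {a} {b} (f′ , qf , f≡) (g′ , qg , g≡) =
    (λ n → f′ n ℚ.+ g′ n) , qp-+ d qf qg , λ n →
      trans (cong₂ ℚ._+_ (f≡ n) (g≡ n))
        (ℚS.solve 5 (λ x a y b z → x ℚS.:+ a ℚS.:* z ℚS.:+ (y ℚS.:+ b ℚS.:* z) ℚS.:=
            x ℚS.:+ y ℚS.:+ (a ℚS.:+ b) ℚS.:* z) refl (f′ n) (a n) (g′ n) (b n) (pow (ιℕ n) d))

  qp-+ zero    f≡0 g≡0 n = cong₂ ℚ._+_ (f≡0 n) (g≡0 n)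
  qp-+ (suc d) (a , pa , fa) (b , pb , gb) =
    (λ n → a n ℚ.+ b n) , (λ n → cong₂ ℚ._+_ (pa n) (pb n)) , leads-+ d {a} {b} fa gb

  qp-scale : ∀ d {a f} → Per a → QP d f → QP d (λ n → a n ℚ.* f n)
  qp-scale zero    {a} pa f≡0 n = trans (cong (a n ℚ.*_) (f≡0 n)) (ℚ.*-zeroʳ (a n))
  qp-scale (suc d) {a} pa (b , pb , g , qg , eq) =
    (λ n → a n ℚ.* b n) , (λ n → cong₂ ℚ._*_ (pa n) (pb n)) ,
    (λ n → a n ℚ.* g n) , qp-scale d pa qg , λ n → trans (cong (a n ℚ.*_) (eq n))
      (ℚS.solve 4 (λ a g b z → a ℚS.:* (g ℚS.:+ b ℚS.:* z) ℚS.:= a ℚS.:* g ℚS.:+ a ℚS.:* b ℚS.:* z)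
        refl (a n) (g n) (b n) (pow (ιℕ n) d))

  qp-up : ∀ d {f} → QP d f → QP (suc d) f
  qp-up d {f} qf = (λ _ → 0ℚ) , (λ _ → refl) , f , qf , λ n →
    sym (trans (cong (f n ℚ.+_) (ℚ.*-zeroˡ (pow (ιℕ n) d))) (ℚ.+-identityʳ (f n)))

  qp-0 : ∀ d → QP d (λ _ → 0ℚ)
  qp-0 zero    n = refl
  qp-0 (suc d) = qp-up d (qp-0 d)

  qp-monomial : ∀ d {a} → Per a → QP (suc d) (λ n → a n ℚ.* pow (ιℕ n) d)
  qp-monomial d {a} pa = a , pa , (λ _ → 0ℚ) , qp-0 d , λ n → sym (ℚ.+-identityˡ _)

  qp-n* : ∀ d {f} → QP d f → QP (suc d) (λ n → ιℕ n ℚ.* f n)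
  qp-n* zero    f≡0 = qp-up 0 λ n → trans (cong (ιℕ n ℚ.*_) (f≡0 n)) (ℚ.*-zeroʳ (ιℕ n))
  qp-n* (suc d) (a , pa , g , qg , eq) = a , pa , (λ n → ιℕ n ℚ.* g n) , qp-n* d qg , λ n →
    trans (cong (ιℕ n ℚ.*_) (eq n))
      (ℚS.solve 4 (λ x g a z → x ℚS.:* (g ℚS.:+ a ℚS.:* z) ℚS.:= x ℚS.:* g ℚS.:+ a ℚS.:* (x ℚS.:* z))
        refl (ιℕ n) (g n) (a n) (pow (ιℕ n) d))

  module _ (s : ℚ) where

    -- In place of the binomial theorem: with y = (x + s)^d and z = x^d, the next difference is x (y
    -- - z) + s (y - z) + s z, of degree at most d.
    power-difference : ∀ d → QP d (λ n → pow (ιℕ n ℚ.+ s) d ℚ.- pow (ιℕ n) d)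
    power-difference zero    n = refl
    power-difference (suc d) = qp-cong (suc d)
      (λ n → ℚS.solve 4 (λ x s y z →
          x ℚS.:* (y ℚS.:- z) ℚS.:+ (s ℚS.:* (y ℚS.:- z) ℚS.:+ s ℚS.:* z) ℚS.:=
          (x ℚS.:+ s) ℚS.:* y ℚS.:- x ℚS.:* z)
        refl (ιℕ n) s (pow (ιℕ n ℚ.+ s) d) (pow (ιℕ n) d))
      (qp-+ (suc d) (qp-n* d (power-difference d))
        (qp-+ (suc d) (qp-up d (qp-scale d {λ _ → s} (λ _ → refl) (power-difference d)))
          (qp-monomial d {λ _ → s} (λ _ → refl))))

    -- The subtracted term is s times the derivative of x^(d+1). The same recursion applies, the
    -- extra s x^(d+1) raising the factor d + 1 to d + 2 at the next degree.
    power-difference-lead : ∀ d → QP d (λ n →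
      pow (ιℕ n ℚ.+ s) (suc d) ℚ.- pow (ιℕ n) (suc d) ℚ.- s ℚ.* ιℕ (suc d) ℚ.* pow (ιℕ n) d)
    power-difference-lead zero    n = ℚS.solve 2 (λ x s →
      (x ℚS.:+ s) ℚS.:* ℚS.con 1ℚ ℚS.:- x ℚS.:* ℚS.con 1ℚ ℚS.:- s ℚS.:* ℚS.con 1ℚ ℚS.:* ℚS.con 1ℚ
        ℚS.:= ℚS.con 0ℚ) refl (ιℕ n) s
    power-difference-lead (suc d) = qp-cong (suc d)
      (λ n → trans
        (ℚS.solve 5 (λ x s y z k →
            x ℚS.:* (y ℚS.:- x ℚS.:* z ℚS.:- s ℚS.:* k ℚS.:* z) ℚS.:+ s ℚS.:* (y ℚS.:- x ℚS.:* z) ℚS.:=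
            (x ℚS.:+ s) ℚS.:* y ℚS.:- x ℚS.:* (x ℚS.:* z) ℚS.:- s ℚS.:* (ℚS.con 1ℚ ℚS.:+ k) ℚS.:* (x ℚS.:* z))
          refl (ιℕ n) s (pow (ιℕ n ℚ.+ s) (suc d)) (pow (ιℕ n) d) (ιℕ (suc d)))
        (cong (λ k → pow (ιℕ n ℚ.+ s) (suc (suc d)) ℚ.- pow (ιℕ n) (suc (suc d)) ℚ.- s ℚ.* k ℚ.* pow (ιℕ n) (suc d))
          (sym (ιℕ-+ 1 (suc d)))))
      (qp-+ (suc d) (qp-n* d (power-difference-lead d))
        (qp-scale (suc d) {λ _ → s} (λ _ → refl) (power-difference (suc d))))

  -- Taking the difference of a n^(d+1) over p multiplies the leading coefficient by p (d + 1);
  -- summation divides by it.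
  unit : ℕ → ℚ
  unit d = (+ 1 / (p * suc d)) {{ℕ.m*n≢0 p (suc d)}}

  unit-cancel : ∀ d → unit d ℚ.* (ιℕ p ℚ.* ιℕ (suc d)) ≡ 1ℚ
  unit-cancel d = trans
    (cong (unit d ℚ.*_) (trans (sym (ι-* (+ p) (+ suc d))) (cong ι (sym (ℤ.pos-* p (suc d))))))
    (/-*-cancel (+ 1) (p * suc d) {{ℕ.m*n≢0 p (suc d)}})

  -- Subtracting a suitable multiple of n^(d+1) lowers the degree of the
  -- difference; a function of zero difference is its own periodic coefficient.

  sum-leads : ∀ d {a f h} → Per a → Leads d a h → (∀ n → f (n + p) ≡ f n ℚ.+ h n) →
              Leads (suc d) (λ n → a n ℚ.* unit d) f
  sum-qp : ∀ d {f h} → QP d h → (∀ n → f (n + p) ≡ f n ℚ.+ h n) → QP (suc d) f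

  sum-leads d {a} {f} {h} pa (g , qg , h≡) step = f′ , sum-qp d qh′ step′ , restore
    where
    e : ℕ → ℚ
    e n = a n ℚ.* unit d

    pe : Per e
    pe n = cong (ℚ._* unit d) (pa n)

    f′ : ℕ → ℚ
    f′ n = f n ℚ.- e n ℚ.* pow (ιℕ n) (suc d)

    D : ℕ → ℚ
    D n = pow (ιℕ n ℚ.+ ιℕ p) (suc d) ℚ.- pow (ιℕ n) (suc d) ℚ.- ιℕ p ℚ.* ιℕ (suc d) ℚ.* pow (ιℕ n) d

    h′ : ℕ → ℚ
    h′ n = g n ℚ.+ (ℚ.- e n) ℚ.* D n

    qh′ : QP d h′
    qh′ = qp-+ d qg (qp-scale d (λ n → cong ℚ.-_ (pe n)) (power-difference-lead (ιℕ p) d))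

    restore : ∀ n → f n ≡ f′ n ℚ.+ e n ℚ.* pow (ιℕ n) (suc d)
    restore n = ℚS.solve 2 (λ f y → f ℚS.:= f ℚS.:- y ℚS.:+ y) refl (f n) (e n ℚ.* pow (ιℕ n) (suc d))

    step′ : ∀ n → f′ (n + p) ≡ f′ n ℚ.+ h′ n
    step′ n = begin
      f (n + p) ℚ.- e (n + p) ℚ.* pow (ιℕ (n + p)) (suc d)
        ≡⟨ cong₂ ℚ._-_ (trans (step n) (cong (f n ℚ.+_) (h≡ n)))
             (cong₂ (λ x y → x ℚ.* pow y (suc d)) (pe n) (ιℕ-+ n p)) ⟩
      f n ℚ.+ (g n ℚ.+ a n ℚ.* z) ℚ.- a n ℚ.* u ℚ.* y
        -- Inserting 1 = u k lets the top term of `h` cancel the leading term in the difference of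
        -- the subtracted power, which leaves `D`.
        ≡⟨ cong (λ w → f n ℚ.+ (g n ℚ.+ w ℚ.* z) ℚ.- a n ℚ.* u ℚ.* y)
             (trans (sym (ℚ.*-identityʳ (a n))) (cong (a n ℚ.*_) (sym (unit-cancel d)))) ⟩
      f n ℚ.+ (g n ℚ.+ a n ℚ.* (u ℚ.* k) ℚ.* z) ℚ.- a n ℚ.* u ℚ.* y
        ≡⟨ ℚS.solve 8 (λ f g a u k z y x →
             f ℚS.:+ (g ℚS.:+ a ℚS.:* (u ℚS.:* k) ℚS.:* z) ℚS.:- a ℚS.:* u ℚS.:* y ℚS.:=
             f ℚS.:- a ℚS.:* u ℚS.:* x ℚS.:+ (g ℚS.:+ (ℚS.:- (a ℚS.:* u)) ℚS.:* (y ℚS.:- x ℚS.:- k ℚS.:* z)))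
           refl (f n) (g n) (a n) u k z y x ⟩
      f′ n ℚ.+ h′ n ∎
      where
      open ≡-Reasoning
      u = unit d
      k = ιℕ p ℚ.* ιℕ (suc d)
      z = pow (ιℕ n) d
      x = pow (ιℕ n) (suc d)
      y = pow (ιℕ n ℚ.+ ιℕ p) (suc d)

  sum-qp zero    {f} h≡0 step = f ,
    (λ n → trans (step n) (trans (cong (f n ℚ.+_) (h≡0 n)) (ℚ.+-identityʳ (f n)))) ,
    (λ _ → 0ℚ) , (λ _ → refl) ,
    λ n → sym (trans (ℚ.+-identityˡ _) (ℚ.*-identityʳ (f n)))
  sum-qp (suc d) (a , pa , lead) step =
    (λ n → a n ℚ.* unit d) , (λ n → cong (ℚ._* unit d) (pa n)) , sum-leads d pa lead step

  -- A translation by s of the polynomial variable and by r of the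
  -- argument of the periodic coefficients.

  Translates : ℚ → ℕ → ℕ → ℕ → Set
  Translates s r n m = ιℕ n ℚ.+ s ≡ ιℕ m × (∀ a → Per a → a (n + r) ≡ a m)

  module _ (s : ℚ) (r : ℕ) where

    -- As (n + s)^d - n^d has degree below d, replacing (n + s)^d by n^d alters only the lower part,
    -- and the top coefficient is merely translated.
    translate-leads : ∀ d {a f} → Per a → Leads d a f →
      ∃ λ f′ → Leads d (λ n → a (n + r)) f′ × (∀ {n m} → Translates s r n m → f′ n ≡ f m)
    translate-qp : ∀ d {f} → QP d f →
      ∃ λ f′ → QP d f′ × (∀ {n m} → Translates s r n m → f′ n ≡ f m)

    per-translate : ∀ {a} → Per a → Per (λ n → a (n + r))
    per-translate {a} pa n = trans (cong a (swap n p r)) (pa (n + r))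
      where
      swap : ∀ n p r → n + p + r ≡ n + r + p
      swap = ℕ-Ring.solve-∀

    translate-leads d {a} {f} pa (g , qg , f≡) with g′ , qg′ , g′≡ ← translate-qp d qg =
      f′ , ((λ n → g′ n ℚ.+ a (n + r) ℚ.* (pow (ιℕ n ℚ.+ s) d ℚ.- pow (ιℕ n) d)) ,
        qp-+ d qg′ (qp-scale d (per-translate pa) (power-difference s d)) ,
        λ n → ℚS.solve 4 (λ g a y z → g ℚS.:+ a ℚS.:* y ℚS.:= g ℚS.:+ a ℚS.:* (y ℚS.:- z) ℚS.:+ a ℚS.:* z)
          refl (g′ n) (a (n + r)) (pow (ιℕ n ℚ.+ s) d) (pow (ιℕ n) d)) ,
      λ {n} {m} tr → trans
        (cong₂ ℚ._+_ (g′≡ tr) (cong₂ (λ x y → x ℚ.* pow y d) (proj₂ tr a pa) (proj₁ tr)))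
        (sym (f≡ m))
      where
      f′ : ℕ → ℚ
      f′ n = g′ n ℚ.+ a (n + r) ℚ.* pow (ιℕ n ℚ.+ s) d

    translate-qp zero    {f} f≡0 = (λ _ → 0ℚ) , (λ _ → refl) , λ {_} {m} _ → sym (f≡0 m)
    translate-qp (suc d) (a , pa , lead) =
      let f′ , lead′ , eq = translate-leads d pa lead in
      f′ , ((λ n → a (n + r)) , per-translate pa , lead′) , eq

  leads-cong : ∀ d {a f g} → (∀ n → f n ≡ g n) → Leads d a f → Leads d a g
  leads-cong d f≗g (h , qh , eq) = h , qh , λ n → trans (sym (f≗g n)) (eq n)

  forward : ∀ d r {a f} → Leads d (λ _ → a) f → Leads d (λ _ → a) (λ n → f (n + r))
  forward d r {a} {f} lead = let f′ , lead′ , eq = translate-leads (ιℕ r) r d {λ _ → a} (λ _ → refl) lead in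
    leads-cong d {λ _ → a} (λ n → eq (sym (ιℕ-+ n r) , λ _ _ → refl)) lead′

  per-multiple : ∀ {a} → Per a → ∀ k n → a (n + k * p) ≡ a n
  per-multiple {a} pa zero    n = cong a (ℕ.+-identityʳ n)
  per-multiple {a} pa (suc k) n = trans (cong a (sym (ℕ.+-assoc n p (k * p))))
    (trans (per-multiple pa k (n + p)) (pa n))

  -- The polynomial variable is translated by -s in ℚ, but the periodic coefficients take only
  -- natural arguments. There s (p - 1) is added instead, which is congruent to -s modulo p.
  backward : ∀ d s {a f} → Leads d (λ _ → a) f →
             ∃ λ f′ → Leads d (λ _ → a) f′ × (∀ n → f′ (s + n) ≡ f n)
  backward d s {a} {f} lead = let f′ , lead′ , eq = translate-leads (ℚ.- ιℕ s) (s * ℕ.pred p) d {λ _ → a} (λ _ → refl) lead in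
    f′ , lead′ , λ n → eq (
      trans (cong (ℚ._- ιℕ s) (ιℕ-+ s n))
        (ℚS.solve 2 (λ s n → s ℚS.:+ n ℚS.:- s ℚS.:= n) refl (ιℕ s) (ιℕ n)) ,
      λ a pa → trans (cong a (multiple n)) (per-multiple pa s n))
    where
    multiple : ∀ n → s + n + s * ℕ.pred p ≡ n + s * p
    multiple n = trans (regroup s n (ℕ.pred p)) (cong (λ p → n + s * p) (ℕ.suc-pred p))
      where
      regroup : ∀ s n q → s + n + s * q ≡ n + s * suc q
      regroup = ℕ-Ring.solve-∀

  -- From nested to explicit coefficients

  sumTo : ℕ → (ℕ → ℚ) → ℚ
  sumTo zero    h = 0ℚ
  sumTo (suc d) h = sumTo d h ℚ.+ h d

  sumTo-cong : ∀ d {h k} → (∀ i → i < d → h i ≡ k i) → sumTo d h ≡ sumTo d k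
  sumTo-cong zero    eq = refl
  sumTo-cong (suc d) eq = cong₂ ℚ._+_ (sumTo-cong d (λ i i<d → eq i (ℕ.m≤n⇒m≤1+n i<d))) (eq d ℕ.≤-refl)

  sumTo-suc : ∀ d h → sumTo (suc d) h ≡ h 0 ℚ.+ sumTo d (h ∘ suc)
  sumTo-suc zero    h = trans (ℚ.+-identityˡ (h 0)) (sym (ℚ.+-identityʳ (h 0)))
  sumTo-suc (suc d) h = trans (cong (ℚ._+ h (suc d)) (sumTo-suc d h)) (ℚ.+-assoc (h 0) _ _)

  sumℚ-allFin : ∀ d h → sumℚ (map (h ∘ toℕ) (allFin d)) ≡ sumTo d h
  sumℚ-allFin d h = trans (cong sumℚ (List.map-tabulate {n = d} id (h ∘ toℕ))) (go d h)
    where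
    go : ∀ d h → sumℚ (tabulate {n = d} (h ∘ toℕ)) ≡ sumTo d h
    go zero    h = refl
    go (suc d) h = trans (cong (h 0 ℚ.+_) (go d (h ∘ suc))) (sym (sumTo-suc d h))

  update : ℕ → (ℕ → ℚ) → (ℕ → ℕ → ℚ) → ℕ → ℕ → ℚ
  update d a coeff i with i ℕ.≟ d
  ... | yes _ = a
  ... | no  _ = coeff i

  update-≡ : ∀ d a coeff → update d a coeff d ≡ a
  update-≡ d a coeff with d ℕ.≟ d
  ... | yes _ = refl
  ... | no ≢  = contradiction refl ≢

  update-< : ∀ d a coeff {i} → i < d → update d a coeff i ≡ coeff i
  update-< d a coeff {i} i<d with i ℕ.≟ d
  ... | yes eq = contradiction eq (ℕ.<⇒≢ i<d)
  ... | no  _  = refl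

  update-per : ∀ d {a coeff} → Per a → (∀ i → Per (coeff i)) → ∀ i → Per (update d a coeff i)
  update-per d pa pc i with i ℕ.≟ d
  ... | yes _ = pa
  ... | no  _ = pc i

  -- Coefficients are indexed by all of ℕ, so that raising the degree overwrites one entry instead
  -- of reindexing the others.
  qp-coefficients : ∀ d {f} → QP d f → ∃ λ (coeff : ℕ → ℕ → ℚ) → (∀ i → Per (coeff i)) ×
    (∀ n → f n ≡ sumTo d (λ i → coeff i n ℚ.* pow (ιℕ n) i))
  leads-coefficients : ∀ d {a f} → Per a → Leads d a f →
    ∃ λ (coeff : ℕ → ℕ → ℚ) → (∀ i → Per (coeff i)) × coeff d ≡ a ×
    (∀ n → f n ≡ sumTo (suc d) (λ i → coeff i n ℚ.* pow (ιℕ n) i))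

  qp-coefficients zero    f≡0 = (λ _ _ → 0ℚ) , (λ _ _ → refl) , f≡0
  qp-coefficients (suc d) (a , pa , lead) =
    let coeff , per , _ , eq = leads-coefficients d {a} pa lead in coeff , per , eq

  leads-coefficients d {a} pa (g , qg , f≡) with coeff , per , g≡ ← qp-coefficients d qg =
    update d a coeff , update-per d pa per , update-≡ d a coeff , λ n →
      trans (f≡ n) (cong₂ ℚ._+_
        (trans (g≡ n) (sumTo-cong d λ i i<d →
          cong (λ c → c n ℚ.* pow (ιℕ n) i) (sym (update-< d a coeff i<d))))
        (cong (λ c → c n ℚ.* pow (ιℕ n) d) (sym (update-≡ d a coeff))))

  leads⇒quasiPolynomial : ∀ d {a f} → a ≢ 0ℚ → Leads d (λ _ → a) f → IsQuasiPolynomial d f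
  leads⇒quasiPolynomial d {a} {f} a≢0 lead
    with coeff , per , top , eq ← leads-coefficients d {λ _ → a} (λ _ → refl) lead = record
    { coeff    = coeff ∘ toℕ
    ; periodic = λ i → p , ℕ.n≢0⇒n>0 (ℕ.≢-nonZero⁻¹ p) , per (toℕ i)
    ; leading  = 0 , λ a≡0 → a≢0 (trans (sym (cong (λ c → c 0) top))
        (trans (cong (λ i → coeff i 0) (sym (Fin.toℕ-fromℕ d))) a≡0))
    ; formula  = λ n → trans (eq n) (trans
        (sumTo-cong (suc d) (λ i _ → cong (coeff i n ℚ.*_) (sym (ιℕ-pow n i))))
        (sym (sumℚ-allFin (suc d) (λ i → coeff i n ℚ.* ιℕ (n ^ i)))))
    }

-- The counting function

-- One of any four consecutive numbers is divisible by 4.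
#weight-4 : ∀ M → #weight 0 (1 + M) + #weight 0 (2 + M) + #weight 0 (3 + M) + #weight 0 (4 + M) ≡ 1
#weight-4 0 = refl
#weight-4 1 = refl
#weight-4 2 = refl
#weight-4 3 = refl
#weight-4 (suc (suc (suc (suc M)))) = #weight-4 M

#weight-step : ∀ j M → #weight (suc j) (4 + M) ≡
  #weight (suc j) M + (#weight j (1 + M) + #weight j (2 + M) + #weight j (3 + M) + #weight j (4 + M))
#weight-step j M = assoc (#weight (suc j) M) (#weight j (1 + M)) (#weight j (2 + M)) (#weight j (3 + M)) (#weight j (4 + M))
  where
  assoc : ∀ s a b c d → s + a + b + c + d ≡ s + (a + b + c + d)
  assoc = ℕ-Ring.solve-∀

positive⇒≢0 : ∀ {a} → ℚ.Positive a → a ≢ 0ℚ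
positive⇒≢0 a>0 refl = ℚ.<-irrefl refl (ℚ.positive⁻¹ 0ℚ {{a>0}})

module _ (t : ℕ) .{{_ : NonZero t}} where

  private
    instance
      period≢0 : NonZero (4 * t)
      period≢0 = ℕ.m*n≢0 4 t

  open QuasiPolynomials (4 * t)

  W : ℕ → ℕ → ℚ
  W j n = ιℕ (#weight j (n div t))

  -- The increment of `W (suc j)` from n to n + 4t: the floor of n / t grows by 4, and each unit
  -- adds one value of the previous count.
  W-block : ℕ → ℕ → ℚ
  W-block j n = W j (n + 1 * t) ℚ.+ W j (n + 2 * t) ℚ.+ W j (n + 3 * t) ℚ.+ W j (n + 4 * t)

  +-*-div : ∀ n i → (n + i * t) div t ≡ i + n div t
  +-*-div n i = trans (DM.+-distrib-/-∣ʳ n (divides i refl))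
    (trans (cong (λ q → n div t + q) (DM.m*n/n≡m i t)) (ℕ.+-comm (n div t) i))

  W-block-≡ : ∀ j n → let M = n div t in W-block j n ≡
    ιℕ (#weight j (1 + M) + #weight j (2 + M) + #weight j (3 + M) + #weight j (4 + M))
  W-block-≡ j n = trans
    (cong₂ ℚ._+_ (cong₂ ℚ._+_ (cong₂ ℚ._+_ (at 1) (at 2)) (at 3)) (at 4))
    (sym (trans (ιℕ-+ (w 1 + w 2 + w 3) (w 4)) (cong (ℚ._+ ιℕ (w 4))
      (trans (ιℕ-+ (w 1 + w 2) (w 3)) (cong (ℚ._+ ιℕ (w 3)) (ιℕ-+ (w 1) (w 2)))))))
    where
    w : ℕ → ℕ
    w i = #weight j (i + n div t)
    at : ∀ i → W j (n + i * t) ≡ ιℕ (w i)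
    at i = cong (ιℕ ∘ #weight j) (+-*-div n i)

  W-step : ∀ j n → W (suc j) (n + 4 * t) ≡ W (suc j) n ℚ.+ W-block j n
  W-step j n = trans (cong (ιℕ ∘ #weight (suc j)) (+-*-div n 4))
    (trans (cong ιℕ (#weight-step j (n div t)))
      (trans (ιℕ-+ (#weight (suc j) (n div t)) _) (cong (W (suc j) n ℚ.+_) (sym (W-block-≡ j n)))))

  unit-positive : ∀ d → ℚ.Positive (unit d)
  unit-positive d = ℚ.normalize-pos 1 (4 * t * suc d) {{ℕ.m*n≢0 (4 * t) (suc d)}}

  scaled-unit-positive : ∀ d a → ℚ.Positive a → ℚ.Positive (a ℚ.* unit d)
  scaled-unit-positive d a a>0 = ℚ.pos*pos⇒pos a {{a>0}} (unit d) {{unit-positive d}}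

  -- The induction starts at `W 1`, whose increments are the constant 1. Afterwards the four
  -- translates in a block share the leading coefficient a, so the increment leads with 4a, and
  -- summation scales this by a positive rational.
  W-leads : ∀ j → ∃ λ a → ℚ.Positive a × Leads (suc j) (λ _ → a) (W (suc j))
  W-leads zero = 1ℚ ℚ.* unit 0 , scaled-unit-positive 0 1ℚ _ ,
    sum-leads 0 {λ _ → 1ℚ} (λ _ → refl)
      ((λ _ → 0ℚ) , (λ _ → refl) , λ n → trans (W-block-≡ 0 n) (cong ιℕ (#weight-4 (n div t))))
      (W-step 0)
  W-leads (suc j) with a , a>0 , lead ← W-leads j =
    4a ℚ.* unit (suc j) , scaled-unit-positive (suc j) 4a pos-4a ,
    sum-leads (suc j) {λ _ → 4a} (λ _ → refl)
      (leads-+ (suc j) {λ _ → a ℚ.+ a ℚ.+ a} {λ _ → a}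
        (leads-+ (suc j) {λ _ → a ℚ.+ a} {λ _ → a}
          (leads-+ (suc j) {λ _ → a} {λ _ → a} (fwd 1) (fwd 2)) (fwd 3)) (fwd 4))
      (W-step (suc j))
    where
    4a = a ℚ.+ a ℚ.+ a ℚ.+ a
    fwd : ∀ i → Leads (suc j) (λ _ → a) (λ n → W (suc j) (n + i * t))
    fwd i = forward (suc j) (i * t) {a} {W (suc j)} lead
    pos-4a : ℚ.Positive 4a
    pos-4a = ℚ.pos+pos⇒pos (a ℚ.+ a ℚ.+ a)
      {{ℚ.pos+pos⇒pos (a ℚ.+ a) {{ℚ.pos+pos⇒pos a {{a>0}} a {{a>0}}}} a {{a>0}}}} a {{a>0}}

  multiple : ℚ → ℕ → ℚ
  multiple a zero    = 0ℚ
  multiple a (suc n) = a ℚ.+ multiple a n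

  multiple-positive : ∀ a → ℚ.Positive a → ∀ n → ℚ.Positive (multiple a (suc n))
  multiple-positive a a>0 zero    = subst ℚ.Positive (sym (ℚ.+-identityʳ a)) a>0
  multiple-positive a a>0 (suc n) = ℚ.pos+pos⇒pos a {{a>0}} (multiple a (suc n)) {{multiple-positive a a>0 n}}

  shifted-sum : ∀ {A : Set} → (ℕ → ℕ) → (A → ℕ) → List A → ℕ → ℕ
  shifted-sum f e xs n = sum (map (λ x → shift 0 (e x) f n) xs)

  module _ (d : ℕ) (a : ℚ) (f : ℕ → ℕ) (lead : Leads d (λ _ → a) (ιℕ ∘ f)) {A : Set} (e : A → ℕ) where

    EventualSum : List A → Set
    EventualSum xs = ∃ λ Q → Leads d (λ _ → multiple a (length xs)) Q ×
      ∃ λ n₀ → ∀ n → n ≥ n₀ → ιℕ (shifted-sum f e xs n) ≡ Q n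

    eventual-sum : ∀ xs → EventualSum xs
    eventual-sum []       = (λ _ → 0ℚ) ,
      ((λ _ → 0ℚ) , qp-0 d , λ n → sym (trans (ℚ.+-identityˡ _) (ℚ.*-zeroˡ (pow (ιℕ n) d)))) ,
      0 , λ _ _ → refl
    eventual-sum (x ∷ xs) = extend-sum (eventual-sum xs) (backward d (e x) {a} {ιℕ ∘ f} lead)
      where
      extend-sum : EventualSum xs →
        (∃ λ f′ → Leads d (λ _ → a) f′ × (∀ n → f′ (e x + n) ≡ ιℕ (f n))) → EventualSum (x ∷ xs)
      extend-sum (Q , leadQ , n₀ , eq) (f′ , lead′ , eq′) =
        (λ n → f′ n ℚ.+ Q n) ,
        leads-+ d {λ _ → a} {λ _ → multiple a (length xs)} {f′} {Q} lead′ leadQ ,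
        -- Below `e x` the count is 0 while the quasi-polynomial `f′` need not be, hence the
        -- threshold; a sum of thresholds exceeds each of them.
        e x + n₀ , λ n n≥ → trans (ιℕ-+ (shift 0 (e x) f n) (shifted-sum f e xs n))
          (cong₂ ℚ._+_ (first n (ℕ.≤-trans (ℕ.m≤m+n (e x) n₀) n≥)) (eq n (ℕ.≤-trans (ℕ.m≤n+m n₀ (e x)) n≥)))
        where
        first : ∀ n → e x ≤ n → ιℕ (shift 0 (e x) f n) ≡ f′ n
        first n e≤n = subst (λ n → ιℕ (shift 0 (e x) f n) ≡ f′ n) (ℕ.m+[n∸m]≡n e≤n)
          (trans (cong ιℕ (shift-+ (e x) f (n ∸ e x))) (sym (eq′ (n ∸ e x))))

  *-/-cancel : ∀ k → (+ (k * t)) / t ≡ ιℕ k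
  *-/-cancel k = *-cancelʳ-≢0 (ιℕ t) (λ eq → ℕ.≢-nonZero⁻¹ t (ℤ.+-injective (ι-injective {+ t} {0ℤ} eq)))
    (trans (/-*-cancel (+ (k * t)) t) (trans (cong ι (ℤ.pos-* k t)) (ι-* (+ k) (+ t))))

  k-value : ∀ k → + k / 1 ≡ (+ (suc k * t) / t) ℚ.- 1ℚ
  k-value k = sym (trans (cong (ℚ._- 1ℚ) (trans (*-/-cancel (suc k)) (ιℕ-+ 1 k)))
    (ℚS.solve 1 (λ k → ℚS.con 1ℚ ℚS.:+ k ℚS.:- ℚS.con 1ℚ ℚS.:= k) refl (ιℕ k)))

  module _ (2≤t : 2 ≤ t) (d₃ kA kB : ℕ) (nonempty : ∃ λ ν → Fibre t (suc kA * t) (suc kB * t) d₃ ν) where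

    private
      d = suc (t ∸ 2)
      bs = branches t d₃ kA kB

      f : ℕ → ℕ
      f n = #weight d (n div t)

      least : Label t → ℕ
      least ℓ@(rA , rB , _) = minSize t 2≤t d₃ kA kB rA rB (c t d₃ kA kB ℓ)

    -- All branches have the same leading coefficient, so their total is its multiple by the number
    -- of branches, positive once there is one. The attained triple provides it.
    positive-count : ∀ {A : Set} {x : A} {a} xs → x ∈ xs → ℚ.Positive a → ℚ.Positive (multiple a (length xs))
    positive-count {a = a} (_ ∷ xs) _ a>0 = multiple-positive a a>0 (length xs)

    count-quasiPolynomial : ∃ λ (Q : ℕ → ℚ) → IsQuasiPolynomial (t ∸ 1) Q ×
      (∃ λ n₀ → ∀ n → n ≥ n₀ → + #size≤ t 2≤t d₃ kA kB n / 1 ≡ Q n)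
    count-quasiPolynomial =
      let a , a>0 , lead = W-leads (t ∸ 2)
          Q , leadQ , eventually = eventual-sum d a f lead least bs
          _ , ℓ∈bs , _ = fibre⇒listed t 2≤t d₃ kA kB (proj₂ nonempty)
      in Q , subst (λ k → IsQuasiPolynomial k Q) (sym (ℕ.+-∸-assoc 1 2≤t))
        (leads⇒quasiPolynomial d {multiple a (length bs)} {Q}
          (positive⇒≢0 (positive-count bs ℓ∈bs a>0)) leadQ) ,
      eventually

corollary3p7 : (t : ℕ) .{{_ : NonZero t}} → 2 ≤ t →
    (d₁ d₂ d₃ : ℕ) → (∃ λ ν → 𝒯 t ν × IntervalTriple t ν d₁ d₂ d₃) →
    Infinite (Fibre t d₁ d₂ d₃)
    ×
    (∃₂ λ (kA kB : ℕ) →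
    (+ kA / 1 ≡ (+ d₁ / t) ℚ.- 1ℚ) × (+ kB / 1 ≡ (+ d₂ / t) ℚ.- 1ℚ)
    ×
    (∀ ν → Fibre t d₁ d₂ d₃ ν ⇔
    (∃ λ ℓ → IsBranch t d₃ kA kB ℓ × Branch t d₃ kA kB ℓ ν))
    ×
    (∀ ℓ ℓ′ → IsBranch t d₃ kA kB ℓ → IsBranch t d₃ kA kB ℓ′ →
    ∀ ν → Branch t d₃ kA kB ℓ ν → Branch t d₃ kA kB ℓ′ ν →
    SameBranch d₃ ℓ ℓ′)
    ×
    (d₃ ≡ 0 → ∀ rA rB →
    (IsBranch t d₃ kA kB (rA , rB , Sign.+) ⇔ IsBranch t d₃ kA kB (rA , rB , Sign.-))
    × (∀ ν → Branch t d₃ kA kB (rA , rB , Sign.+) ν ⇔ Branch t d₃ kA kB (rA , rB , Sign.-) ν))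
    ×
    (∀ ℓ → IsBranch t d₃ kA kB ℓ →
    (∀ v m → 0ℤ ℤ.⊔ c t d₃ kA kB ℓ ℤ.≤ v →
    ∃! _≡_ (BranchPoint t d₃ kA kB ℓ v m))
    × (∀ v v′ m m′ ν → BranchPoint t d₃ kA kB ℓ v m ν → BranchPoint t d₃ kA kB ℓ v′ m′ ν →
    v ≡ v′ × (∀ i i≢rA i≢rB → m i i≢rA i≢rB ≡ m′ i i≢rA i≢rB)))
    ×
    (∃ λ (F : ℕ → ℕ) →
    (∀ n → HasCardinality (λ ν → Fibre t d₁ d₂ d₃ ν × ∣ ν ∣ₚ ≡ n) (F n))
    × ((λ n → + F n)
    ≗ Σˢ (branches t d₃ kA kB) (λ ℓ → q^ (exponent t d₃ kA kB ℓ))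
    ÷ ((1ˢ ⊖ q^ (+ (4 * t))) ⊛ (1ˢ ⊖ q^ (+ t)) ^ˢ (t ∸ 2)))))
    ×
    (∃ λ (G : ℕ → ℕ) →
    (∀ n → HasCardinality (λ ν → Fibre t d₁ d₂ d₃ ν × ∣ ν ∣ₚ ≤ n) (G n))
    × (∃ λ (Q : ℕ → ℚ) → IsQuasiPolynomial (t ∸ 1) Q
    × (∃ λ n₀ → ∀ n → n ≥ n₀ → + G n / 1 ≡ Q n)))
corollary3p7 t 2≤t d₁ d₂ d₃ (ν , T@(partition , _) , I) =
  let _ , _ , kA , kB , _ , _ , d₁≡ , d₂≡ , _ = triple⇒coded t partition I

      -- An attained triple has d₁ and d₂ of the form (k + 1) t, the form in which the fibre was
      -- analysed.
      transport : (P : ℕ → ℕ → Set) → P (suc kA * t) (suc kB * t) → P d₁ d₂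
      transport P = subst₂ P (sym d₁≡) (sym d₂≡)

      nonempty = ν , subst₂ (λ d₁ d₂ → Fibre t d₁ d₂ d₃ ν) d₁≡ d₂≡ (T , I)
  in
  transport (λ d₁ d₂ → Infinite (Fibre t d₁ d₂ d₃)) (fibre-infinite t d₃ kA kB nonempty) ,
  (kA , kB ,
    transport (λ d₁ _ → + kA / 1 ≡ (+ d₁ / t) ℚ.- 1ℚ) (k-value t kA) ,
    transport (λ _ d₂ → + kB / 1 ≡ (+ d₂ / t) ℚ.- 1ℚ) (k-value t kB) ,
    (λ ν → transport (λ d₁ d₂ → Fibre t d₁ d₂ d₃ ν ⇔ (∃ λ ℓ → IsBranch t d₃ kA kB ℓ × Branch t d₃ kA kB ℓ ν))
      (fibre⇔branch t d₃ kA kB ν)) ,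
    branches-disjoint t d₃ kA kB ,
    signs-agree t d₃ kA kB ,
    (λ ℓ isBranch → branchPoint-exists t d₃ kA kB ℓ isBranch , branchPoint-params-unique t d₃ kA kB ℓ) ,
    #size t 2≤t d₃ kA kB ,
    (λ n → transport (λ d₁ d₂ → HasCardinality (λ ν → Fibre t d₁ d₂ d₃ ν × ∣ ν ∣ₚ ≡ n) (#size t 2≤t d₃ kA kB n))
      (card-size t 2≤t d₃ kA kB n)) ,
    generating-function t 2≤t d₃ kA kB) ,
  #size≤ t 2≤t d₃ kA kB ,
  (λ n → transport (λ d₁ d₂ → HasCardinality (λ ν → Fibre t d₁ d₂ d₃ ν × ∣ ν ∣ₚ ≤ n) (#size≤ t 2≤t d₃ kA kB n))
    (card-size≤ t 2≤t d₃ kA kB n)) ,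
  count-quasiPolynomial t 2≤t d₃ kA kB nonempty
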